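{- Let $q\ge3$ be an integer and $0\le\beta<1$. Let $\mathcal{G}$ be a family of finite graphs such that (i) the function $\delta$ defined by $\delta(d)=\frac{2(1-\beta)}{q-1-(1-\beta)d}$ if $d\le\frac{q-1}{1-\beta}-2$ and $\delta(d)=1$ otherwise, is a contraction function for $\mathcal{G}$; and (ii) if $\beta=0$, every graph in $\mathcal{G}$ is properly $q$-colorable. Then the $q$-state Potts model with activity $\beta$ exhibits strong spatial mixing on all graphs in $\mathcal{G}$: there exist constants $C>0$ and $0<\gamma<1$ such that for every $G=(V,E)\in\mathcal{G}$ with $n=|V|$, every $v\in V$, every $\Lambda\subseteq V$, every $x\in[q]$, and every $\sigma,\tau\in[q]^\Lambda$ such that $\Omega_1=(G,\Lambda,\sigma)$ and $\Omega_2=(G,\Lambda,\tau)$ are both feasible, $$\left|\Pr_{\Omega_1}[c(v)=x]-\Pr_{\Omega_2}[c(v)=x]\right|\le n^C\gamma^{\mathrm{dist}_G(v,D)},$$ where $D\subseteq\Lambda$ is the set of vertices on which $\sigma$ and $\tau$ differ.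
   Context: Potts model: fix an integer $q\ge2$ and a real $\beta\ge0$ (activity); $[q]=\{1,\dots,q\}$ and $0^0=1$. For a finite undirected graph $G=(V,E)$, an instance is a triple $\Omega=(G,\Lambda,\sigma)$ with $\Lambda\subseteq V$ and $\sigma\in[q]^\Lambda$. For $\pi\in[q]^V$, $w_\Omega(\pi)=\beta^{|\{uv\in E:\pi(u)=\pi(v)\}|}$ if $\pi$ agrees with $\sigma$ on $\Lambda$, and $w_\Omega(\pi)=0$ otherwise. $\Omega$ is feasible if some $\pi$ has $w_\Omega(\pi)>0$; then $Z(\Omega)=\sum_{\pi\in[q]^V}w_\Omega(\pi)$ and the Gibbs measure is $\Pr_\Omega[c(V)=\pi]=w_\Omega(\pi)/Z(\Omega)$ ($c$ is the random configuration); $\Pr_\Omega[c(v)=x]$ and $\Pr_\Omega[c(S)=\pi]$ are its marginals. $\mathrm{dist}_G(v,D)$ is the minimum graph distance from $v$ to a vertex of $D$ (taken to be $+\infty$ if $D=\emptyset$ or no vertex of $D$ is reachable, with $\gamma^{+\infty}=0$). Self-avoiding walks and contraction function: $\mathsf{SAW}(v,\ell)$ is the set of self-avoiding walks $(v,v_1,\dots,v_\ell)$ in $G$ with $\ell$ edges from $v$; $\mathcal{E}_\delta(v,\ell)=\sum_{(v,v_1,\dots,v_\ell)\in\mathsf{SAW}(v,\ell)}\prod_{i=1}^\ell\delta(\deg_G(v_i))$; $\delta:\mathbb{N}\to\mathbb{R}^+$ is a contraction function for a family $\mathcal{G}$ if there are constants $C>0$, $0<\gamma<1$ with $\mathcal{E}_\delta(v,\ell)<n^C\gamma^\ell$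 for every $G=(V,E)\in\mathcal{G}$, $n=|V|$, every vertex $v$ and every $\ell\ge1$. -}

module Defs where

open import Algebra.Bundles using (CommutativeRing; Semiring)
import Algebra.Definitions.RawSemiring as RawSemiring
open import Data.Bool.Base using (if_then_else_)
open import Data.Fin.Base as Fin using (Fin; inject₁; finToFun)
open import Data.Fin.Properties as Fin using (all?)
open import Data.Fin.Subset using (Subset; _∈_)
open import Data.Fin.Subset.Properties using (_∈?_)
open import Data.List.Base using (List; allFin; cartesianProduct; filter; length)
open import Data.Nat.Base as ℕ using (ℕ; zero; suc)
import Data.Nat.Properties as ℕ
open import Data.Product.Base using (Σ-syntax; ∃; ∃-syntax; _×_; _,_; proj₁; proj₂)
open import Data.Sum.Base using (inj₁; inj₂)
open import Data.Vec.Functional as Vector using (Vector)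
open import Function.Definitions using (Injective)
open import Level as Level using (0ℓ; _⊔_)
open import Relation.Binary.Core using (Rel)
open import Relation.Binary.Definitions using (Decidable; Irreflexive; Symmetric; tri<; tri≈; tri>)
open import Relation.Binary.PropositionalEquality.Core as ≡ using (_≡_; _≢_)
open import Relation.Binary.Structures using (IsStrictTotalOrder)
import Relation.Binary.Construct.StrictToNonStrict as StrictToNonStrict
open import Relation.Nullary.Construct.Add.Supremum using (_⁺; ⊤⁺; [_])
open import Relation.Nullary.Decidable.Core using (Dec; yes; no; does; _×-dec_; _→-dec_)
import Relation.Nullary.Decidable as Dec
open import Relation.Nullary.Negation using (¬_; contradiction)

-- The real numbers, axiomatised as the Dedekind-complete (archimedean) ordered
-- field, which is unique up to isomorphism.  The order is decidable, as it is
-- classically.  Archimedeanness follows from completeness classically; it is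
-- listed because extracting the natural number is not constructive.

record RealNumbers : Set₁ where
  infix  4 _<_
  infix  8 _⁻¹
  infixl 7 _/_

  field
    commutativeRing : CommutativeRing 0ℓ 0ℓ

  open CommutativeRing commutativeRing public
    renaming (Carrier to ℝ; zero to *-zero)

  open RawSemiring (Semiring.rawSemiring semiring) public
    using (_^_; sum; product)
    renaming (_×_ to _·_)

  ι : ℕ → ℝ
  ι n = n · 1#

  field
    _<_                : Rel ℝ 0ℓ
    isStrictTotalOrder : IsStrictTotalOrder _≈_ _<_
    0<1                : 0# < 1#
    +-monoˡ-<          : ∀ x {y z} → y < z → x + y < x + z
    *-monoˡ-<-pos      : ∀ {x y z} → 0# < x → y < z → x * y < x * z
    -- The value of 0⁻¹ is left unspecified.
    _⁻¹                : ℝ → ℝ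
    ⁻¹-inverseʳ        : ∀ x → ¬ (x ≈ 0#) → x * x ⁻¹ ≈ 1#

  open StrictToNonStrict _≈_ _<_ public using (_≤_)

  IsUpperBound : (ℝ → Set) → ℝ → Set
  IsUpperBound P b = ∀ x → P x → x ≤ b

  IsSupremum : (ℝ → Set) → ℝ → Set
  IsSupremum P s = IsUpperBound P s × (∀ b → IsUpperBound P b → s ≤ b)

  field
    archimedean : ∀ x → ∃[ n ] x < ι n
    complete    : (P : ℝ → Set) → ∃ P → ∃ (IsUpperBound P) → ∃ (IsSupremum P)

  module < = IsStrictTotalOrder isStrictTotalOrder

  _≟_ : Decidable _≈_
  _≟_ = <._≟_

  _≤?_ : Decidable _≤_
  _≤?_ = StrictToNonStrict.decidable′ _≈_ _<_ <.compare

  _/_ : ℝ → ℝ → ℝ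
  x / y = x * y ⁻¹

  ∣_∣ : ℝ → ℝ
  ∣ x ∣ = if does (0# ≤? x) then x else - x


module RealPower (ℛ : RealNumbers) where
  open RealNumbers ℛ

  import Algebra.Properties.Semiring.Exp semiring as Exp
  import Algebra.Properties.Semiring.Mult semiring as Mult

  ≤-trans : ∀ {x y z} → x ≤ y → y ≤ z → x ≤ z
  ≤-trans = StrictToNonStrict.trans _≈_ _<_ isEquivalence <.<-resp-≈ <.trans

  ≤-<-trans : ∀ {x y z} → x ≤ y → y < z → x < z
  ≤-<-trans = StrictToNonStrict.≤-<-trans _≈_ _<_ sym <.trans <.<-respˡ-≈

  ≤-resp : ∀ {x x′ y y′} → x ≈ x′ → y ≈ y′ → x ≤ y → x′ ≤ y′
  ≤-resp p q (inj₁ r) = inj₁ (<.<-respˡ-≈ p (<.<-respʳ-≈ q r))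
  ≤-resp p q (inj₂ r) = inj₂ (trans (sym p) (trans r q))

  ≤⇒≯ : ∀ {x y} → x ≤ y → ¬ (y < x)
  ≤⇒≯ x≤y y<x = <.irrefl refl (≤-<-trans x≤y y<x)

  ≮⇒≥ : ∀ {x y} → ¬ (x < y) → y ≤ x
  ≮⇒≥ {x} {y} x≮y with <.compare x y
  ... | tri< x<y _ _ = contradiction x<y x≮y
  ... | tri≈ _ x≈y _ = inj₂ (sym x≈y)
  ... | tri> _ _ y<x = inj₁ y<x

  *-monoˡ : ∀ {x y z} → 0# ≤ x → y ≤ z → x * y ≤ x * z
  *-monoˡ (inj₁ p) (inj₁ q) = inj₁ (*-monoˡ-<-pos p q)
  *-monoˡ (inj₁ p) (inj₂ q) = inj₂ (*-congˡ q)
  *-monoˡ {x} {y} {z} (inj₂ p) _ = inj₂ (trans (vanish y) (sym (vanish z)))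
    where
    vanish : ∀ w → x * w ≈ 0#
    vanish w = trans (*-congʳ (sym p)) (zeroˡ w)

  *-monoʳ : ∀ {x y z} → 0# ≤ x → y ≤ z → y * x ≤ z * x
  *-monoʳ p q = ≤-resp (*-comm _ _) (*-comm _ _) (*-monoˡ p q)

  *-pos : ∀ {x y} → 0# < x → 0# < y → 0# < x * y
  *-pos {x} p q = <.<-respˡ-≈ (zeroʳ x) (*-monoˡ-<-pos p q)

  ^-pos : ∀ {x} → 0# < x → ∀ k → 0# < x ^ k
  ^-pos p zero    = 0<1
  ^-pos p (suc k) = *-pos p (^-pos p k)

  ^-monoˡ : ∀ {x y} → 0# ≤ x → x ≤ y → 0# < y → ∀ k → x ^ k ≤ y ^ k
  ^-monoˡ p q r zero    = inj₂ refl
  ^-monoˡ {x} {y} p q r (suc k) =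
    ≤-trans (*-monoˡ p (^-monoˡ p q r k)) (*-monoʳ (inj₁ (^-pos r k)) q)

  ^-monoˡ-< : ∀ {x y} → 0# < x → x < y → ∀ k → x ^ suc k < y ^ suc k
  ^-monoˡ-< {x} {y} p q k =
    ≤-<-trans (*-monoˡ (inj₁ p) (^-monoˡ (inj₁ p) (inj₁ q) y>0 k))
      (<.<-respˡ-≈ (*-comm _ _) (<.<-respʳ-≈ (*-comm _ _)
        (*-monoˡ-<-pos (^-pos y>0 k) q)))
    where
    y>0 : 0# < y
    y>0 = <.trans p q

  ^-monoʳ : ∀ {x} → 1# ≤ x → 0# < x → ∀ {j k} → j ℕ.≤ k → x ^ j ≤ x ^ k
  ^-monoʳ 1≤x 0<x {k = zero}  ℕ.z≤n = inj₂ refl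
  ^-monoʳ 1≤x 0<x {k = suc k} ℕ.z≤n =
    ≤-trans (^-monoʳ 1≤x 0<x {k = k} ℕ.z≤n)
      (≤-resp (*-identityˡ _) refl (*-monoʳ (inj₁ (^-pos 0<x k)) 1≤x))
  ^-monoʳ 1≤x 0<x (ℕ.s≤s p) = *-monoˡ (inj₁ 0<x) (^-monoʳ 1≤x 0<x p)

  x<1+x : ∀ x → x < 1# + x
  x<1+x x = <.<-respˡ-≈ (+-identityʳ x) (<.<-respʳ-≈ (+-comm x 1#) (+-monoˡ-< x 0<1))

  0≤ι : ∀ n → 0# ≤ ι n
  0≤ι zero    = inj₂ refl
  0≤ι (suc n) = ≤-trans (0≤ι n) (inj₁ (x<1+x (ι n)))

  0<ι-suc : ∀ n → 0# < ι (suc n)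
  0<ι-suc n = ≤-<-trans (0≤ι n) (x<1+x (ι n))

  1≤ι-suc : ∀ n → 1# ≤ ι (suc n)
  1≤ι-suc zero    = inj₂ (sym (+-identityʳ 1#))
  1≤ι-suc (suc n) = ≤-trans (1≤ι-suc n) (inj₁ (x<1+x _))

  ι-mono-< : ∀ {m n} → m ℕ.< n → ι m < ι n
  ι-mono-< {zero}  {suc n} _         = 0<ι-suc n
  ι-mono-< {suc m} {suc n} (ℕ.s≤s p) = +-monoˡ-< 1# (ι-mono-< p)

  ι-cancel-≤ : ∀ {m n} → ι m ≤ ι n → m ℕ.≤ n
  ι-cancel-≤ p = ℕ.≮⇒≥ (λ q → ≤⇒≯ p (ι-mono-< q))

  ι-* : ∀ m n → ι m * ι n ≈ ι (m ℕ.* n)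
  ι-* m n = trans (Mult.×-assoc-* m 1# (ι n))
           (trans (Mult.×-congʳ m (*-identityˡ (ι n))) (Mult.×-assocˡ 1# m n))

  -- { y : y ≤ n^(a/b) for some rational 0 ≤ a/b ≤ C }, with b = suc b′.
  BelowPower : ℕ → ℝ → ℝ → Set
  BelowPower n C y =
    ∃[ a ] ∃[ b′ ] ι a ≤ C * ι (suc b′) × y ^ suc b′ ≤ ι n ^ a

  inhabited : ∀ n C → 0# < C → ∃ (BelowPower n C)
  inhabited n C C>0 = 0# , 0 , 0
    , ≤-resp (zeroʳ C) refl (*-monoˡ (inj₁ C>0) (0≤ι 1))
    , ≤-resp (sym (zeroˡ 1#)) refl (inj₁ 0<1)

  bounded : ∀ n C → ∃ (IsUpperBound (BelowPower n C))
  bounded n C = B , isUB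
    where
    m : ℕ
    m = proj₁ (archimedean C)

    N B : ℝ
    N = ι (suc n)
    B = N ^ m

    isUB : IsUpperBound (BelowPower n C) B
    isUB y (a , b′ , a≤Cb , yᵇ≤nᵃ) = ≮⇒≥ λ B<y →
      ≤⇒≯ (≤-trans yᵇ≤nᵃ (≤-trans nᵃ≤Nᵃ Nᵃ≤Bᵇ))
        (^-monoˡ-< (^-pos (0<ι-suc n) m) B<y b′)
      where
      b : ℕ
      b = suc b′

      a≤mb : a ℕ.≤ m ℕ.* b
      a≤mb = ι-cancel-≤ (≤-trans a≤Cb
        (≤-resp refl (ι-* m b) (*-monoʳ (0≤ι b) (inj₁ (proj₂ (archimedean C))))))

      nᵃ≤Nᵃ : ι n ^ a ≤ N ^ a
      nᵃ≤Nᵃ = ^-monoˡ (0≤ι n) (inj₁ (x<1+x (ι n))) (0<ι-suc n) a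

      Nᵃ≤Bᵇ : N ^ a ≤ B ^ b
      Nᵃ≤Bᵇ = ≤-resp refl (sym (Exp.^-assocʳ N m b))
        (^-monoʳ (1≤ι-suc n) (0<ι-suc n) a≤mb)

  -- n^C for a real exponent C > 0, as the supremum of the powers n^(a/b) with
  -- a/b ≤ C.  This is the usual power for n ≥ 1; the case n = 0 never arises
  -- below, since n is the order of a graph with a vertex.
  power : ℕ → (C : ℝ) → 0# < C → ℝ
  power n C C>0 =
    proj₁ (complete (BelowPower n C) (inhabited n C C>0) (bounded n C))

  power-isSupremum : ∀ n C C>0 → IsSupremum (BelowPower n C) (power n C C>0)
  power-isSupremum n C C>0 =
    proj₂ (complete (BelowPower n C) (inhabited n C C>0) (bounded n C))


record Graph : Set₁ where
  field
    order      : ℕ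
    Adj        : Rel (Fin order) 0ℓ
    Adj?       : Decidable Adj
    Adj-sym    : Symmetric Adj
    Adj-irrefl : Irreflexive _≡_ Adj

  Vertex : Set
  Vertex = Fin order

  deg : Vertex → ℕ
  deg v = length (filter (Adj? v) (allFin order))

  -- Each edge is listed once, with its smaller endpoint first.
  edges : List (Vertex × Vertex)
  edges = filter (λ (u , v) → (u Fin.<? v) ×-dec Adj? u v)
                 (cartesianProduct (allFin order) (allFin order))

  ProperlyColorable : ℕ → Set
  ProperlyColorable q = Σ[ f ∈ (Vertex → Fin q) ] (∀ u v → Adj u v → f u ≢ f v)

  data Walk : Vertex → Vertex → ℕ → Set where
    []  : ∀ {v} → Walk v v 0
    _∷_ : ∀ {u v w k} → Adj u v → Walk v w k → Walk u w (suc k)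

  IsDistance : Vertex → (Vertex → Set) → ℕ ⁺ → Set
  IsDistance v D [ k ] = (∃[ u ] D u × Walk v u k)
                       × (∀ u j → D u → Walk v u j → k ℕ.≤ j)
  IsDistance v D ⊤⁺    = ∀ u j → D u → ¬ Walk v u j

  IsSAW : ∀ {ℓ} → Vector Vertex (suc ℓ) → Set
  IsSAW {ℓ} p = Injective _≡_ _≡_ p
              × (∀ (i : Fin ℓ) → Adj (p (inject₁ i)) (p (Fin.suc i)))

  isSAW? : ∀ {ℓ} (p : Vector Vertex (suc ℓ)) → Dec (IsSAW p)
  isSAW? p =
    Dec.map′ (λ h {i} {j} → h i j) (λ h i j → h {i} {j})
      (all? λ i → all? λ j → (p i Fin.≟ p j) →-dec (i Fin.≟ j))
    ×-dec all? (λ i → Adj? (p (inject₁ i)) (p (Fin.suc i)))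

open Graph public using (order; Vertex; ProperlyColorable; IsDistance)


PartialConfiguration : ℕ → ∀ {n} → Subset n → Set
PartialConfiguration q Λ = ∀ v → .(v ∈ Λ) → Fin q

Difference : ∀ {q n} {Λ : Subset n} (σ τ : PartialConfiguration q Λ) → Fin n → Set
Difference {Λ = Λ} σ τ v = Σ[ v∈Λ ∈ v ∈ Λ ] σ v v∈Λ ≢ τ v v∈Λ

record Instance (q : ℕ) : Set₁ where
  constructor ⟨_,_,_⟩
  field
    G : Graph
    Λ : Subset (order G)
    σ : PartialConfiguration q Λ

  Agrees : (Vertex G → Fin q) → Set
  Agrees π = ∀ v (v∈Λ : v ∈ Λ) → π v ≡ σ v v∈Λ

  agrees? : ∀ π → Dec (Agrees π)
  agrees? π = all? agreesAt?
    where
    agreesAt? : ∀ v → Dec ((v∈Λ : v ∈ Λ) → π v ≡ σ v v∈Λ)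
    agreesAt? v with v ∈? Λ
    ... | no  v∉Λ = yes λ v∈Λ → contradiction v∈Λ v∉Λ
    ... | yes v∈Λ = Dec.map′ (λ eq _ → eq) (λ h → h v∈Λ) (π v Fin.≟ σ v v∈Λ)


module Potts (ℛ : RealNumbers) where
  open RealNumbers ℛ
  open RealPower ℛ public using (power; power-isSupremum)

  -- finToFun enumerates the functions Fin n → Fin m without repetition.
  ∑-functions : ∀ {m n} → ((Fin n → Fin m) → ℝ) → ℝ
  ∑-functions {m} {n} f = sum {m ℕ.^ n} (λ i → f (finToFun i))

  module Gibbs {q : ℕ} (β : ℝ) (Ω : Instance q) where
    open Instance Ω
    open Graph G using (edges)

    monochromatic : (Vertex G → Fin q) → ℕ
    monochromatic π = length (filter (λ (u , v) → π u Fin.≟ π v) edges)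

    weight : (Vertex G → Fin q) → ℝ
    weight π = if does (agrees? π) then β ^ monochromatic π else 0#

    Feasible : Set
    Feasible = ∃[ π ] 0# < weight π

    Z : ℝ
    Z = ∑-functions weight

    Pr : (Vertex G → Fin q) → ℝ
    Pr π = weight π / Z

    marginal : Vertex G → Fin q → ℝ
    marginal v x = ∑-functions λ π → if does (π v Fin.≟ x) then Pr π else 0#

  open Gibbs public using (Feasible; marginal)

  -- ℰ_δ(v, ℓ); the sum runs over all (v₁, …, v_ℓ) ∈ V^ℓ, and only those for
  -- which (v, v₁, …, v_ℓ) is a self-avoiding walk contribute.
  ℰ : (G : Graph) → (ℕ → ℝ) → Vertex G → ℕ → ℝ
  ℰ G δ v ℓ = ∑-functions {n = ℓ} λ p →
    if does (isSAW? (v Vector.∷ p)) then product (λ i → δ (deg (p i))) else 0#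
    where open Graph G

  IsContractionFunction : ∀ {a} → (Graph → Set a) → (ℕ → ℝ) → Set (Level.suc 0ℓ ⊔ a)
  IsContractionFunction 𝒢 δ =
    (∀ d → 0# < δ d) ×
    (∃[ C ] Σ[ C>0 ∈ 0# < C ] ∃[ γ ] 0# < γ × γ < 1# ×
      (∀ G → 𝒢 G → ∀ (v : Vertex G) ℓ → 1 ℕ.≤ ℓ →
        ℰ G δ v ℓ < power (order G) C C>0 * γ ^ ℓ))

  pottsδ : ℕ → ℝ → ℕ → ℝ
  pottsδ q β d =
    if does (ι d ≤? (((ι q - 1#) / (1# - β)) - ι 2))
    then (ι 2 * (1# - β)) / ((ι q - 1#) - (1# - β) * ι d)
    else 1#

  -- γ^d for a possibly infinite distance d, with γ^∞ = 0.
  infixr 8 _^⁺_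
  _^⁺_ : ℝ → ℕ ⁺ → ℝ
  γ ^⁺ [ k ] = γ ^ k
  γ ^⁺ ⊤⁺    = 0#

{-# OPTIONS --safe #-}

-- The influence of a boundary vertex u on v is bounded by walking from u to v.  A vertex f whose
-- colour is known acts on each neighbour through a separate directed message, so a change of the
-- colour of f can be split into changes of one message f → w at a time.  Such a change moves the
-- distribution of the colour of w by at most min(1, (1-β)/(q-(1-β)deg w)) ≤ δ(deg w) in total
-- variation; conditioning on the colour of w then reduces the problem to a change of the colour
-- of w in the model in which the messages of f are frozen.  Iterating, the influence of u is at
-- most a sum over self-avoiding walks from u to v of products of δ, which read backwards are the
-- walks of ℰ.
--
-- The argument conditions on arbitrary colours and so needs β > 0.  Since it gives bounds in terms
-- of δ for the given β that hold for every activity in [β, 1), the case β = 0 follows by letting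
-- the activity tend to 0.

module Submission where

open import Defs
import Algebra.Properties.CommutativeMonoid.Sum as CommutativeMonoidSum
import Algebra.Properties.CommutativeSemiring.Exp as CommutativeExp
import Algebra.Properties.Ring as RingProperties
import Algebra.Properties.Semiring.Exp as SemiringExp
import Algebra.Properties.Semiring.Mult as SemiringMult
import Algebra.Properties.Semiring.Mult.TCOptimised as SemiringMult′
import Algebra.Properties.Semiring.Sum as SemiringSum
import Algebra.Solver.Ring as RingSolver
open import Algebra.Bundles using (CommutativeRing)
open import Algebra.Solver.Ring.AlmostCommutativeRing using (fromCommutativeRing; _-Raw-AlmostCommutative⟶_)
open import Data.Bool.Base using (Bool; true; false; if_then_else_)
open import Data.Fin.Base as Fin using (Fin; zero; suc; fromℕ; inject₁; finToFun; combine; _↑ˡ_; _↑ʳ_)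
import Data.Fin.Properties as Fin
open import Data.Fin.Subset using (Subset; _∈_)
open import Data.Fin.Subset.Properties using (_∈?_)
open import Data.Integer.Base as ℤ using (ℤ; +_; -[1+_])
import Data.Integer.Properties as ℤ
open import Data.List.Base as List using (List; []; foldr; filter; tabulate; cartesianProduct) renaming (_∷_ to _∷ₗ_)
open import Data.List.Properties using (filter-≐)
open import Data.Maybe.Base using (Maybe; just; nothing)
open import Data.Nat.Base as ℕ using (ℕ; zero; suc)
import Data.Nat.Properties as ℕ
open import Data.Product.Base using (Σ-syntax; ∃-syntax; _×_; _,_; proj₁; proj₂)
open import Data.Sum.Base using (_⊎_; inj₁; inj₂; [_,_]′)
open import Data.Vec.Functional as Vector using (Vector; _∷_; updateAt)
open import Data.Vec.Functional.Properties using (updateAt-updates; updateAt-minimal)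
open import Function.Base using (_∘_; const)
open import Relation.Binary.Definitions using (tri<; tri≈; tri>)
open import Relation.Binary.PropositionalEquality.Core as ≡ using (_≡_; _≢_; _≗_)
import Relation.Binary.Reasoning.Setoid as SetoidReasoning
open import Relation.Nullary.Construct.Add.Supremum using (_⁺; ⊤⁺; [_])
open import Relation.Nullary.Decidable using (dec-true; dec-false)
open import Relation.Nullary.Decidable.Core using (Dec; yes; no; does; _×-dec_; _→-dec_)
open import Relation.Nullary.Negation using (¬_; contradiction)
open import Relation.Unary using (Pred; Decidable)

-- The one-step bound: changing the message `f → w` from `a` to `b` raises the weight of colour `a`
-- at `w`, lowers that of `b` at most by the factor `β`, and changes no other. From the larger total
-- weight to the smaller, only one probability can fall, by at most `1 - β` times its old value.
-- That value is at most `1 / (q - (1 - β) deg w)`, because each neighbour of `w` penalises a single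
-- colour, by `1 - β`. Walks are self-avoiding because a message between two vertices of known
-- colour is a constant factor and cancels in the marginal. The constants: a walk from `u` to `v`
-- collects factors strictly between its ends, whereas `ℰ` also has the factor of `u`. The uniform
-- lower bound `(1 - β) / q` of `δ` pays for it, and the sum over at most `n` lengths costs a factor
-- `n`. Both are absorbed into a power of `n`, so `γ` is kept and only `C` grows. For the limit, the
-- inequality is multiplied by both partition functions; each sum then differs from its value at
-- activity 0 by at most a constant times the activity, and no quotient has to converge.

module IntegerSolver {c ℓ} (R : CommutativeRing c ℓ) where
  open CommutativeRing R
  open RingProperties ring
  open SemiringMult′ semiring using (×1-homo-*) renaming (_×_ to _·_; ×-homo-+ to ·-homo-+)
  open SetoidReasoning setoid

  private
    -- With this form of the multiple, 0 and 1 go to `0#` and `1#` definitionally, so `𝟎` and `𝟏`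
    -- can be used in solved identities without conversion.
    ι : ℕ → Carrier
    ι n = n · 1#

    fromℤ : ℤ → Carrier
    fromℤ (+ n)    = ι n
    fromℤ -[1+ n ] = - ι (suc n)

    fromℤ-neg : ∀ n → fromℤ (ℤ.- (+ n)) ≈ - ι n
    fromℤ-neg zero    = sym -0#≈0#
    fromℤ-neg (suc n) = refl

    cancel-1 : ∀ a b → a - b ≈ (1# + a) - (1# + b)
    cancel-1 a b = begin
      a - b                   ≈⟨ +-congʳ (+-identityˡ a) ⟨
      0# + a - b              ≈⟨ +-congʳ (+-congʳ (-‿inverseʳ 1#)) ⟨
      1# - 1# + a - b         ≈⟨ +-congʳ (+-assoc _ _ _) ⟩
      1# + (- 1# + a) - b     ≈⟨ +-congʳ (+-congˡ (+-comm _ _)) ⟩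
      1# + (a - 1#) - b       ≈⟨ +-congʳ (+-assoc _ _ _) ⟨
      1# + a - 1# - b         ≈⟨ +-assoc _ _ _ ⟩
      1# + a + (- 1# - b)     ≈⟨ +-congˡ (-‿+-comm 1# b) ⟩
      (1# + a) - (1# + b)     ∎

    fromℤ-⊖ : ∀ m n → fromℤ (m ℤ.⊖ n) ≈ ι m - ι n
    fromℤ-⊖ m zero = begin
      ι m          ≈⟨ +-identityʳ _ ⟨
      ι m + 0#     ≈⟨ +-congˡ -0#≈0# ⟨
      ι m - 0#     ∎
    fromℤ-⊖ zero (suc n) = trans (fromℤ-neg (suc n)) (sym (+-identityˡ _))
    fromℤ-⊖ (suc m) (suc n) rewrite ℤ.[1+m]⊖[1+n]≡m⊖n m n =
      trans (fromℤ-⊖ m n) (trans (cancel-1 (ι m) (ι n))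
        (sym (+-cong (·-homo-+ 1# 1 m) (-‿cong (·-homo-+ 1# 1 n)))))

    +-homo : ∀ i j → fromℤ (i ℤ.+ j) ≈ fromℤ i + fromℤ j
    +-homo (+ m) (+ n) = ·-homo-+ 1# m n
    +-homo (+ m) -[1+ n ] = fromℤ-⊖ m (suc n)
    +-homo -[1+ m ] (+ n) = trans (fromℤ-⊖ n (suc m)) (+-comm _ _)
    +-homo -[1+ m ] -[1+ n ] = begin
      - fromℤ (+ suc (suc (m ℕ.+ n)))       ≡⟨ ≡.cong (λ k → - fromℤ (+ suc k)) (ℕ.+-suc m n) ⟨
      - fromℤ (+ (suc m ℕ.+ suc n))         ≈⟨ -‿cong (+-homo (+ suc m) (+ suc n)) ⟩
      - (fromℤ (+ suc m) + fromℤ (+ suc n)) ≈⟨ -‿+-comm _ _ ⟨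
      - fromℤ (+ suc m) - fromℤ (+ suc n)   ∎

    -‿homo : ∀ i → fromℤ (ℤ.- i) ≈ - fromℤ i
    -‿homo (+ zero)  = sym -0#≈0#
    -‿homo (+ suc n) = refl
    -‿homo -[1+ n ]  = sym (-‿involutive _)

    *-homo-+ : ∀ m n → fromℤ (+ m ℤ.* + n) ≈ fromℤ (+ m) * fromℤ (+ n)
    *-homo-+ m n rewrite ≡.sym (ℤ.pos-* m n) = ×1-homo-* m n

    *-homo : ∀ i j → fromℤ (i ℤ.* j) ≈ fromℤ i * fromℤ j
    *-homo (+ m) (+ n) = *-homo-+ m n
    *-homo (+ m) -[1+ n ] = begin
      fromℤ (+ m ℤ.* -[1+ n ])             ≡⟨ ≡.cong fromℤ (ℤ.neg-distribʳ-* (+ m) (+ suc n)) ⟨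
      fromℤ (ℤ.- (+ m ℤ.* + suc n))        ≈⟨ -‿homo (+ m ℤ.* + suc n) ⟩
      - fromℤ (+ m ℤ.* + suc n)            ≈⟨ -‿cong (*-homo-+ m (suc n)) ⟩
      - (fromℤ (+ m) * fromℤ (+ suc n))    ≈⟨ -‿distribʳ-* _ _ ⟩
      fromℤ (+ m) * - fromℤ (+ suc n)      ∎
    *-homo -[1+ m ] j = begin
      fromℤ (-[1+ m ] ℤ.* j)               ≡⟨ ≡.cong fromℤ (ℤ.neg-distribˡ-* (+ suc m) j) ⟨
      fromℤ (ℤ.- (+ suc m ℤ.* j))          ≈⟨ -‿homo (+ suc m ℤ.* j) ⟩
      - fromℤ (+ suc m ℤ.* j)              ≈⟨ -‿cong (pos j) ⟩
      - (fromℤ (+ suc m) * fromℤ j)        ≈⟨ -‿distribˡ-* _ _ ⟩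
      - fromℤ (+ suc m) * fromℤ j          ∎
      where
      pos : ∀ j → fromℤ (+ suc m ℤ.* j) ≈ fromℤ (+ suc m) * fromℤ j
      pos (+ n) = *-homo-+ (suc m) n
      pos -[1+ n ] = begin
        fromℤ (+ suc m ℤ.* -[1+ n ])           ≡⟨ ≡.cong fromℤ (ℤ.neg-distribʳ-* (+ suc m) (+ suc n)) ⟨
        fromℤ (ℤ.- (+ suc m ℤ.* + suc n))      ≈⟨ -‿homo (+ suc m ℤ.* + suc n) ⟩
        - fromℤ (+ suc m ℤ.* + suc n)          ≈⟨ -‿cong (*-homo-+ (suc m) (suc n)) ⟩
        - (fromℤ (+ suc m) * fromℤ (+ suc n))  ≈⟨ -‿distribʳ-* _ _ ⟩
        fromℤ (+ suc m) * - fromℤ (+ suc n)    ∎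

    morphism : ℤ.+-*-rawRing -Raw-AlmostCommutative⟶ fromCommutativeRing R
    morphism = record
      { ⟦_⟧    = fromℤ
      ; +-homo = +-homo
      ; *-homo = *-homo
      ; -‿homo = -‿homo
      ; 0-homo = refl
      ; 1-homo = refl
      }

    _coeff≟_ : ∀ i j → Maybe (fromℤ i ≈ fromℤ j)
    i coeff≟ j with i ℤ.≟ j
    ... | yes ≡.refl = just refl
    ... | no  _      = nothing

  open RingSolver ℤ.+-*-rawRing (fromCommutativeRing R) morphism _coeff≟_ public
    using (solve; Polynomial; con; _:+_; _:*_; _:-_; :-_; _:=_)

  𝟎 𝟏 : ∀ {n} → Polynomial n
  𝟎 = con (+ 0)
  𝟏 = con (+ 1)

-- Order, division and indicators in the real field.

module OrderedField (ℛ : RealNumbers) where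
  open RealNumbers ℛ
  open RealPower ℛ public
    using (≤-trans; ≤-<-trans; ≤-resp; ≤⇒≯; ≮⇒≥; *-monoˡ; *-monoʳ; *-pos; ^-pos; 0≤ι; 0<ι-suc; 1≤ι-suc)
  open IntegerSolver commutativeRing public

  ≤-refl : ∀ {x} → x ≤ x
  ≤-refl = inj₂ refl

  ≤-reflexive : ∀ {x y} → x ≈ y → x ≤ y
  ≤-reflexive = inj₂

  ≤-respˡ : ∀ {x x′ y} → x ≈ x′ → x ≤ y → x′ ≤ y
  ≤-respˡ p = ≤-resp p refl

  ≤-respʳ : ∀ {x y y′} → y ≈ y′ → x ≤ y → x ≤ y′
  ≤-respʳ p = ≤-resp refl p

  <-≤-trans : ∀ {x y z} → x < y → y ≤ z → x < z
  <-≤-trans x<y (inj₁ y<z) = <.trans x<y y<z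
  <-≤-trans x<y (inj₂ y≈z) = <.<-respʳ-≈ y≈z x<y

  ≤-total : ∀ x y → x ≤ y ⊎ y ≤ x
  ≤-total x y with <.compare x y
  ... | tri< x<y _ _ = inj₁ (inj₁ x<y)
  ... | tri≈ _ x≈y _ = inj₁ (inj₂ x≈y)
  ... | tri> _ _ y<x = inj₂ (inj₁ y<x)

  0≤1 : 0# ≤ 1#
  0≤1 = inj₁ 0<1

  +-monoʳ-≤ : ∀ x {y z} → y ≤ z → x + y ≤ x + z
  +-monoʳ-≤ x (inj₁ y<z) = inj₁ (+-monoˡ-< x y<z)
  +-monoʳ-≤ x (inj₂ y≈z) = inj₂ (+-congˡ y≈z)

  +-mono-≤ : ∀ {w x y z} → w ≤ x → y ≤ z → w + y ≤ x + z
  +-mono-≤ {w} {x} {y} {z} w≤x y≤z =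
    ≤-trans (+-monoʳ-≤ w y≤z) (≤-resp (+-comm z w) (+-comm z x) (+-monoʳ-≤ z w≤x))

  +-nonneg : ∀ {x y} → 0# ≤ x → 0# ≤ y → 0# ≤ x + y
  +-nonneg p q = ≤-respˡ (+-identityˡ 0#) (+-mono-≤ p q)

  *-nonneg : ∀ {x y} → 0# ≤ x → 0# ≤ y → 0# ≤ x * y
  *-nonneg {x} p q = ≤-respˡ (zeroʳ x) (*-monoˡ p q)

  x≤x+y : ∀ {x y} → 0# ≤ y → x ≤ x + y
  x≤x+y {x} p = ≤-respˡ (+-identityʳ x) (+-monoʳ-≤ x p)

  ≤-by : ∀ {x y} e → 0# ≤ e → x + e ≈ y → x ≤ y
  ≤-by e p q = ≤-respʳ q (x≤x+y p)

  x≤y⇒0≤y-x : ∀ {x y} → x ≤ y → 0# ≤ y - x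
  x≤y⇒0≤y-x {x} {y} p = ≤-resp (-‿inverseˡ x) (+-comm (- x) y) (+-monoʳ-≤ (- x) p)

  0≤y-x⇒x≤y : ∀ {x y} → 0# ≤ y - x → x ≤ y
  0≤y-x⇒x≤y {x} {y} p = ≤-by (y - x) p
    (solve 2 (λ x y → x :+ (y :- x) := y) refl x y)

  x<y⇒0<y-x : ∀ {x y} → x < y → 0# < y - x
  x<y⇒0<y-x {x} {y} p =
    <.<-respˡ-≈ (-‿inverseˡ x) (<.<-respʳ-≈ (+-comm (- x) y) (+-monoˡ-< (- x) p))

  *-mono-≤ : ∀ {w x y z} → 0# ≤ w → w ≤ x → 0# ≤ y → y ≤ z → w * y ≤ x * z
  *-mono-≤ 0≤w w≤x 0≤y y≤z =
    ≤-trans (*-monoˡ 0≤w y≤z) (*-monoʳ (≤-trans 0≤y y≤z) w≤x)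

  *-cancelˡ-≤ : ∀ {c x y} → 0# < c → c * x ≤ c * y → x ≤ y
  *-cancelˡ-≤ 0<c p = ≮⇒≥ λ y<x → ≤⇒≯ p (*-monoˡ-<-pos 0<c y<x)

  pos⇒≉0 : ∀ {x} → 0# < x → ¬ (x ≈ 0#)
  pos⇒≉0 0<x x≈0 = <.irrefl (sym x≈0) 0<x

  *-cancelˡ-≈ : ∀ {c x y} → 0# < c → c * x ≈ c * y → x ≈ y
  *-cancelˡ-≈ 0<c p with *-cancelˡ-≤ 0<c (inj₂ p) | *-cancelˡ-≤ 0<c (inj₂ (sym p))
  ... | inj₂ x≈y | _        = x≈y
  ... | inj₁ _   | inj₂ y≈x = sym y≈x
  ... | inj₁ x<y | inj₁ y<x = contradiction y<x (<.asym x<y)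

  ⁻¹-pos : ∀ {x} → 0# < x → 0# < x ⁻¹
  ⁻¹-pos {x} 0<x with <.compare 0# (x ⁻¹)
  ... | tri< p _ _ = p
  ... | tri≈ _ p _ = contradiction 0<1 (<.irrefl
    (trans (trans (sym (zeroʳ x)) (*-congˡ p)) (⁻¹-inverseʳ x (pos⇒≉0 0<x))))
  ... | tri> _ _ p = contradiction 0<1 (<.asym (<.<-respʳ-≈ (zeroʳ x)
    (<.<-respˡ-≈ (⁻¹-inverseʳ x (pos⇒≉0 0<x)) (*-monoˡ-<-pos 0<x p))))

  *-/-cancel : ∀ {x} y → 0# < x → x * (y / x) ≈ y
  *-/-cancel {x} y 0<x = trans
    (solve 3 (λ x y z → x :* (y :* z) := y :* (x :* z)) refl x y (x ⁻¹))
    (trans (*-congˡ (⁻¹-inverseʳ x (pos⇒≉0 0<x))) (*-identityʳ y))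

  /-unique : ∀ {x y z} → 0# < x → x * z ≈ y → z ≈ y / x
  /-unique {y = y} 0<x p = *-cancelˡ-≈ 0<x (trans p (sym (*-/-cancel y 0<x)))

  /-nonneg : ∀ {x y} → 0# ≤ y → 0# < x → 0# ≤ y / x
  /-nonneg p q = *-nonneg p (inj₁ (⁻¹-pos q))

  ≤-/ : ∀ {x y z} → 0# < x → z * x ≤ y → z ≤ y / x
  ≤-/ {x} {y} {z} 0<x p =
    *-cancelˡ-≤ 0<x (≤-resp (*-comm z x) (sym (*-/-cancel y 0<x)) p)

  /-≤ : ∀ {x y z} → 0# < x → y ≤ z * x → y / x ≤ z
  /-≤ {x} {y} {z} 0<x p =
    *-cancelˡ-≤ 0<x (≤-resp (sym (*-/-cancel y 0<x)) (*-comm z x) p)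

  abs-≤ : ∀ {x b} → x ≤ b → - x ≤ b → ∣ x ∣ ≤ b
  abs-≤ {x} p q with 0# ≤? x
  ... | yes _ = p
  ... | no  _ = q

  x-y≤b : ∀ {x y b} → x ≤ y + b → x - y ≤ b
  x-y≤b {x} {y} {b} p = 0≤y-x⇒x≤y (≤-respʳ
    (solve 3 (λ x y b → (y :+ b) :- x := b :- (x :- y)) refl x y b) (x≤y⇒0≤y-x p))

  ∣x-y∣≤b : ∀ {x y b} → x ≤ y + b → y ≤ x + b → ∣ x - y ∣ ≤ b
  ∣x-y∣≤b {x} {y} p q = abs-≤ (x-y≤b p)
    (≤-respˡ (solve 2 (λ x y → y :- x := :- (x :- y)) refl x y) (x-y≤b q))

  -- If t = x - y were positive, then ε = t / (t + K + 1) would give a contradiction.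
  limit-≤ : ∀ {x y K} → 0# ≤ K → (∀ ε → 0# < ε → ε < 1# → x ≤ y + ε * K) → x ≤ y
  limit-≤ {x} {y} {K} 0≤K h = ≮⇒≥ λ y<x →
    let
      t     = x - y
      s     = t + (K + 1#)
      ε     = t / s
      0<t   = x<y⇒0<y-x y<x
      0<K+1 = <-≤-trans 0<1 (≤-respʳ (+-comm 1# K) (x≤x+y 0≤K))
      t<s   = <.<-respˡ-≈ (+-identityʳ t) (+-monoˡ-< t 0<K+1)
      0<s   = <.trans 0<t t<s
      0<ε   = *-pos 0<t (⁻¹-pos 0<s)
      ε<1   = <.<-respʳ-≈ (⁻¹-inverseʳ s (pos⇒≉0 0<s))
                (<.<-respˡ-≈ (*-comm _ _) (<.<-respʳ-≈ (*-comm _ _)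
                  (*-monoˡ-<-pos (⁻¹-pos 0<s) t<s)))
      t≤εK  = x-y≤b (h ε 0<ε ε<1)
      st≤tK = ≤-respʳ (trans (sym (*-assoc s ε K)) (*-congʳ (*-/-cancel t 0<s)))
                (*-monoˡ (inj₁ 0<s) t≤εK)
      K<s   = ≤-<-trans (≤-respˡ (+-identityʳ K) (+-monoʳ-≤ K (inj₁ 0<t)))
                (<.<-respˡ-≈ refl (<.<-respʳ-≈
                  (solve 2 (λ K t → (K :+ t) :+ 𝟏 := t :+ (K :+ 𝟏)) refl K t)
                  (<.<-respˡ-≈ (+-identityʳ (K + t)) (+-monoˡ-< (K + t) 0<1))))
    in ≤⇒≯ (≤-respˡ (*-comm s t) st≤tK) (*-monoˡ-<-pos 0<t K<s)

  𝟙 : ∀ {a} {A : Set a} → Dec A → ℝ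
  𝟙 A? = if does A? then 1# else 0#

  𝟙-yes : ∀ {a} {A : Set a} (A? : Dec A) → A → 𝟙 A? ≈ 1#
  𝟙-yes (yes _) _ = refl
  𝟙-yes (no ¬a) a = contradiction a ¬a

  𝟙-no : ∀ {a} {A : Set a} (A? : Dec A) → ¬ A → 𝟙 A? ≈ 0#
  𝟙-no (yes a) ¬a = contradiction a ¬a
  𝟙-no (no _)  _  = refl

  𝟙-cong : ∀ {a b} {A : Set a} {B : Set b} (A? : Dec A) (B? : Dec B) →
           (A → B) → (B → A) → 𝟙 A? ≈ 𝟙 B?
  𝟙-cong (yes a) B? f g = sym (𝟙-yes B? (f a))
  𝟙-cong (no ¬a) B? f g = sym (𝟙-no B? λ b → ¬a (g b))

  0≤𝟙 : ∀ {a} {A : Set a} (A? : Dec A) → 0# ≤ 𝟙 A?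
  0≤𝟙 (yes _) = 0≤1
  0≤𝟙 (no _)  = ≤-refl

  𝟙≤1 : ∀ {a} {A : Set a} (A? : Dec A) → 𝟙 A? ≤ 1#
  𝟙≤1 (yes _) = ≤-refl
  𝟙≤1 (no _)  = 0≤1

  if-𝟙 : ∀ {a} {A : Set a} (A? : Dec A) x → (if does A? then x else 0#) ≈ 𝟙 A? * x
  if-𝟙 (yes _) x = sym (*-identityˡ x)
  if-𝟙 (no _)  x = sym (zeroˡ x)

  𝟙-*-zero : ∀ {a b} {A : Set a} {B : Set b} (A? : Dec A) (B? : Dec B) x →
             (A → ¬ B) → 𝟙 A? * (𝟙 B? * x) ≈ 0#
  𝟙-*-zero (no _)  B? x ¬ab = zeroˡ _
  𝟙-*-zero (yes a) B? x ¬ab = trans (*-congˡ (trans (*-congʳ (𝟙-no B? (¬ab a))) (zeroˡ x))) (zeroʳ _)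

  𝟙-*-cong : ∀ {a} {A : Set a} (A? : Dec A) {x y} → (A → x ≈ y) → 𝟙 A? * x ≈ 𝟙 A? * y
  𝟙-*-cong (yes a) x≈y = *-congˡ (x≈y a)
  𝟙-*-cong (no _)  _   = trans (zeroˡ _) (sym (zeroˡ _))

-- Finite sums and products, and sums over all colourings.

module Sums (ℛ : RealNumbers) where
  open RealNumbers ℛ
  open OrderedField ℛ
  open SetoidReasoning setoid
  open SemiringSum semiring public
    using (sum-replicate; ∑-distrib-+; ∑-comm; *-distribˡ-sum)
  open CommutativeMonoidSum *-commutativeMonoid public
    using () renaming (sum-cong-≋ to product-cong; ∑-distrib-+ to ∏-distrib-*; sum-replicate-zero to product-replicate-one)
  open SemiringSum semiring using (sum-cong-≋)
  open SemiringMult semiring using (×-assoc-*; ×-congʳ)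

  sum-cong : ∀ {n} {f g : Vector ℝ n} → (∀ i → f i ≈ g i) → sum f ≈ sum g
  sum-cong = sum-cong-≋

  sum-mono : ∀ {n} {f g : Vector ℝ n} → (∀ i → f i ≤ g i) → sum f ≤ sum g
  sum-mono {zero}  p = ≤-refl
  sum-mono {suc n} p = +-mono-≤ (p zero) (sum-mono (p ∘ suc))

  sum-nonneg : ∀ {n} {f : Vector ℝ n} → (∀ i → 0# ≤ f i) → 0# ≤ sum f
  sum-nonneg {zero}  p = ≤-refl
  sum-nonneg {suc n} p = +-nonneg (p zero) (sum-nonneg (p ∘ suc))

  sum-const : ∀ n x → sum {n} (λ _ → x) ≈ ι n * x
  sum-const n x = begin
    sum {n} (λ _ → x)  ≈⟨ sum-replicate n ⟩
    n · x              ≈⟨ ×-congʳ n (*-identityˡ x) ⟨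
    n · (1# * x)       ≈⟨ ×-assoc-* n 1# x ⟨
    ι n * x            ∎

  sum-zero : ∀ {n} {f : Vector ℝ n} → (∀ i → f i ≈ 0#) → sum f ≈ 0#
  sum-zero {n} p = trans (sum-cong p) (trans (sum-const n 0#) (zeroʳ _))

  sum-𝟙 : ∀ {n} (j : Fin n) (f : Vector ℝ n) → sum (λ i → 𝟙 (i Fin.≟ j) * f i) ≈ f j
  sum-𝟙 {suc n} zero f = begin
    1# * f zero + sum (λ i → 0# * f (suc i))  ≈⟨ +-cong (*-identityˡ _) (sum-zero {n} λ i → zeroˡ (f (suc i))) ⟩
    f zero + 0#                               ≈⟨ +-identityʳ _ ⟩
    f zero                                    ∎
  sum-𝟙 (suc j) f = begin
    0# * f zero + sum (λ i → 𝟙 (suc i Fin.≟ suc j) * f (suc i))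
      ≈⟨ +-cong (zeroˡ _) (sum-cong λ i → *-congʳ (𝟙-cong (suc i Fin.≟ suc j) (i Fin.≟ j) Fin.suc-injective (≡.cong suc))) ⟩
    0# + sum (λ i → 𝟙 (i Fin.≟ j) * f (suc i))
      ≈⟨ +-identityˡ _ ⟩
    sum (λ i → 𝟙 (i Fin.≟ j) * f (suc i))
      ≈⟨ sum-𝟙 j (f ∘ suc) ⟩
    f (suc j) ∎

  product-pos : ∀ {n} {f : Vector ℝ n} → (∀ i → 0# < f i) → 0# < product f
  product-pos {zero}  p = 0<1
  product-pos {suc n} p = *-pos (p zero) (product-pos (p ∘ suc))

  product-nonneg : ∀ {n} {f : Vector ℝ n} → (∀ i → 0# ≤ f i) → 0# ≤ product f
  product-nonneg {zero}  p = 0≤1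
  product-nonneg {suc n} p = *-nonneg (p zero) (product-nonneg (p ∘ suc))

  product≤1 : ∀ {n} {f : Vector ℝ n} → (∀ i → 0# ≤ f i) → (∀ i → f i ≤ 1#) → product f ≤ 1#
  product≤1 {zero}  p q = ≤-refl
  product≤1 {suc n} p q = ≤-respʳ (*-identityˡ 1#)
    (*-mono-≤ (p zero) (q zero) (product-nonneg (p ∘ suc)) (product≤1 (p ∘ suc) (q ∘ suc)))

  product-one : ∀ {n} {f : Vector ℝ n} → (∀ i → f i ≈ 1#) → product f ≈ 1#
  product-one {n} p = trans (product-cong p) (product-replicate-one n)

  -- The Weierstrass product inequality. The slack of the induction step is the slack for the tail
  -- plus `(1 - f₀) (1 - P)`.
  bernoulli : ∀ {n} {f : Vector ℝ n} → (∀ i → 0# ≤ f i) → (∀ i → f i ≤ 1#) →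
              1# ≤ product f + sum (λ i → 1# - f i)
  bernoulli {zero}      p q = ≤-reflexive (sym (+-identityʳ 1#))
  bernoulli {suc n} {f} p q = ≤-by e 0≤e
    (solve 3 (λ f₀ P S → 𝟏 :+ ((P :+ S :- 𝟏) :+ (𝟏 :- f₀) :* (𝟏 :- P))
                      := f₀ :* P :+ ((𝟏 :- f₀) :+ S)) refl f₀ P S)
    where
    f₀ = f zero
    P  = product (f ∘ suc)
    S  = sum (λ i → 1# - f (suc i))
    e  = (P + S - 1#) + (1# - f₀) * (1# - P)
    0≤e = +-nonneg (x≤y⇒0≤y-x (bernoulli (p ∘ suc) (q ∘ suc)))
      (*-nonneg (x≤y⇒0≤y-x (q zero)) (x≤y⇒0≤y-x (product≤1 (p ∘ suc) (q ∘ suc))))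

  -- The two products have ratio `f j : g j`; the cross-multiplied form needs no factor to be
  -- nonzero.
  product-exchange : ∀ {n} (f g : Vector ℝ n) j → (∀ i → i ≢ j → f i ≈ g i) →
                     product f * g j ≈ product g * f j
  product-exchange f g zero p = begin
    f zero * product (f ∘ suc) * g zero  ≈⟨ *-congʳ (*-congˡ (product-cong λ i → p (suc i) λ ())) ⟩
    f zero * product (g ∘ suc) * g zero  ≈⟨ solve 3 (λ a P b → a :* P :* b := b :* P :* a) refl _ _ _ ⟩
    g zero * product (g ∘ suc) * f zero  ∎
  product-exchange f g (suc j) p = begin
    f zero * product (f ∘ suc) * g (suc j)    ≈⟨ *-assoc _ _ _ ⟩
    f zero * (product (f ∘ suc) * g (suc j))  ≈⟨ *-cong (p zero λ ()) (product-exchange (f ∘ suc) (g ∘ suc) j λ i i≢j → p (suc i) (i≢j ∘ Fin.suc-injective)) ⟩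
    g zero * (product (g ∘ suc) * f (suc j))  ≈⟨ *-assoc _ _ _ ⟨
    g zero * product (g ∘ suc) * f (suc j)    ∎

  sum-++ : ∀ m {n} (f : Vector ℝ (m ℕ.+ n)) → sum f ≈ sum (λ i → f (i ↑ˡ n)) + sum (λ j → f (m ↑ʳ j))
  sum-++ zero    f = sym (+-identityˡ _)
  sum-++ (suc m) f = trans (+-congˡ (sum-++ m (f ∘ suc))) (sym (+-assoc _ _ _))

  sum-combine : ∀ m {k} (f : Vector ℝ (m ℕ.* k)) → sum f ≈ sum (λ i → sum (λ j → f (combine {m} i j)))
  sum-combine zero    f = refl
  sum-combine (suc m) {k} f = trans (sum-++ k f) (+-congˡ (sum-combine m (λ i → f (k ↑ʳ i))))

  -- In the absence of function extensionality, reindexing a sum over colourings requires that the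
  -- summand not separate pointwise equal colourings.
  Extensional : ∀ {q n} → ((Fin n → Fin q) → ℝ) → Set
  Extensional F = ∀ {π ρ} → π ≗ ρ → F π ≈ F ρ

  private module P = Potts ℛ

  term≤sum : ∀ {n} {f : Vector ℝ n} → (∀ i → 0# ≤ f i) → ∀ i → f i ≤ sum f
  term≤sum p zero    = x≤x+y (sum-nonneg (p ∘ suc))
  term≤sum p (suc i) = ≤-trans (term≤sum (p ∘ suc) i) (≤-respʳ (+-comm _ _) (x≤x+y (p zero)))

  ∷-cong : ∀ {q n} (y : Fin q) {π ρ : Fin n → Fin q} → π ≗ ρ → y ∷ π ≗ y ∷ ρ
  ∷-cong y p zero    = ≡.refl
  ∷-cong y p (suc i) = p i

  infixl 6 _[_≔_]
  _[_≔_] : ∀ {a} {A : Set a} {n} → (Fin n → A) → Fin n → A → Fin n → A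
  f [ i ≔ x ] = updateAt f i (const x)

  opaque
    -- Summing coordinate by coordinate opens `∑-functions` to induction on `n`. Opacity keeps the
    -- nested sums folded in later goals.
    ∑ᶠ : ∀ {q n} → ((Fin n → Fin q) → ℝ) → ℝ
    ∑ᶠ {n = zero}  F = F Vector.[]
    ∑ᶠ {n = suc n} F = sum λ y → ∑ᶠ λ π → F (y ∷ π)

    ∑ᶠ-[] : ∀ {q} (F : (Fin 0 → Fin q) → ℝ) → ∑ᶠ F ≈ F Vector.[]
    ∑ᶠ-[] F = refl

    ∑ᶠ-∷ : ∀ {q n} (F : (Fin (suc n) → Fin q) → ℝ) → ∑ᶠ F ≈ sum (λ y → ∑ᶠ (λ π → F (y ∷ π)))
    ∑ᶠ-∷ F = refl

    ∑-functions-∑ᶠ : ∀ {q n} (F : (Fin n → Fin q) → ℝ) → Extensional F → P.∑-functions F ≈ ∑ᶠ F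
    ∑-functions-∑ᶠ {q} {zero}  F ext = trans (+-identityʳ _) (ext λ ())
    ∑-functions-∑ᶠ {q} {suc n} F ext = begin
      sum (λ i → F (finToFun {q} {suc n} i))
        ≈⟨ sum-combine q {q ℕ.^ n} (λ i → F (finToFun {q} {suc n} i)) ⟩
      sum (λ y → sum (λ j → F (finToFun {q} {suc n} (combine {q} {q ℕ.^ n} y j))))
        ≈⟨ sum-cong {q} (λ y → sum-cong {q ℕ.^ n} λ j → ext (decode y j)) ⟩
      sum (λ y → P.∑-functions (λ π → F (y ∷ π)))
        ≈⟨ sum-cong {q} (λ y → ∑-functions-∑ᶠ (λ π → F (y ∷ π)) λ p → ext (∷-cong y p)) ⟩
      sum (λ y → ∑ᶠ λ π → F (y ∷ π))  ∎
      where
      decode : ∀ y j → finToFun {q} {suc n} (combine {q} {q ℕ.^ n} y j) ≗ y ∷ finToFun j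
      decode y j zero    = ≡.cong proj₁ (Fin.remQuot-combine {q} y j)
      decode y j (suc i) = ≡.cong (λ r → finToFun (proj₂ r) i) (Fin.remQuot-combine {q} y j)

    ∑ᶠ-cong : ∀ {q n} {F G : (Fin n → Fin q) → ℝ} → (∀ π → F π ≈ G π) → ∑ᶠ F ≈ ∑ᶠ G
    ∑ᶠ-cong {n = zero}  p = p _
    ∑ᶠ-cong {n = suc n} p = sum-cong λ y → ∑ᶠ-cong λ π → p (y ∷ π)

    ∑ᶠ-mono : ∀ {q n} {F G : (Fin n → Fin q) → ℝ} → (∀ π → F π ≤ G π) → ∑ᶠ F ≤ ∑ᶠ G
    ∑ᶠ-mono {n = zero}  p = p _
    ∑ᶠ-mono {n = suc n} p = sum-mono λ y → ∑ᶠ-mono λ π → p (y ∷ π)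

    ∑ᶠ-distrib-+ : ∀ {q n} (F G : (Fin n → Fin q) → ℝ) → ∑ᶠ (λ π → F π + G π) ≈ ∑ᶠ F + ∑ᶠ G
    ∑ᶠ-distrib-+ {n = zero}  F G = refl
    ∑ᶠ-distrib-+ {n = suc n} F G = trans
      (sum-cong λ y → ∑ᶠ-distrib-+ (λ π → F (y ∷ π)) (λ π → G (y ∷ π)))
      (∑-distrib-+ (λ y → ∑ᶠ λ π → F (y ∷ π)) (λ y → ∑ᶠ λ π → G (y ∷ π)))

    *-distribˡ-∑ᶠ : ∀ {q n} x (F : (Fin n → Fin q) → ℝ) → x * ∑ᶠ F ≈ ∑ᶠ (λ π → x * F π)
    *-distribˡ-∑ᶠ {n = zero}  x F = refl
    *-distribˡ-∑ᶠ {n = suc n} x F = trans (*-distribˡ-sum x λ y → ∑ᶠ λ π → F (y ∷ π))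
      (sum-cong λ y → *-distribˡ-∑ᶠ x λ π → F (y ∷ π))

    ∑ᶠ-zero : ∀ {q n} {F : (Fin n → Fin q) → ℝ} → (∀ π → F π ≈ 0#) → ∑ᶠ F ≈ 0#
    ∑ᶠ-zero {n = zero}  p = p _
    ∑ᶠ-zero {n = suc n} p = sum-zero λ y → ∑ᶠ-zero λ π → p (y ∷ π)

    ∑ᶠ-nonneg : ∀ {q n} {F : (Fin n → Fin q) → ℝ} → (∀ π → 0# ≤ F π) → 0# ≤ ∑ᶠ F
    ∑ᶠ-nonneg {n = zero}  p = p _
    ∑ᶠ-nonneg {n = suc n} p = sum-nonneg λ y → ∑ᶠ-nonneg λ π → p (y ∷ π)

    ∑-∑ᶠ-comm : ∀ {k q n} (F : Fin k → (Fin n → Fin q) → ℝ) →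
                sum (λ i → ∑ᶠ (F i)) ≈ ∑ᶠ (λ π → sum (λ i → F i π))
    ∑-∑ᶠ-comm {n = zero}  F = refl
    ∑-∑ᶠ-comm {n = suc n} F = trans
      (∑-comm λ i y → ∑ᶠ λ π → F i (y ∷ π))
      (sum-cong λ y → ∑-∑ᶠ-comm λ i π → F i (y ∷ π))

    term≤∑ᶠ : ∀ {q n} {F : (Fin n → Fin q) → ℝ} → Extensional F → (∀ π → 0# ≤ F π) → ∀ π → F π ≤ ∑ᶠ F
    term≤∑ᶠ {n = zero}  ext p π = ≤-reflexive (ext λ ())
    term≤∑ᶠ {n = suc n} {F} ext p π = ≤-trans
      (≤-respˡ (ext λ { zero → ≡.refl ; (suc i) → ≡.refl })
        (term≤∑ᶠ {F = λ ρ → F (π zero ∷ ρ)} (λ e → ext (∷-cong _ e)) (λ ρ → p _) (π ∘ suc)))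
      (term≤sum (λ y → ∑ᶠ-nonneg λ ρ → p (y ∷ ρ)) (π zero))

    -- Every colouring arises `q` times as `π [ i ≔ y ]`, once for each overwritten value of `π i`.
    ∑ᶠ-update : ∀ {q n} (F : (Fin n → Fin q) → ℝ) → Extensional F → ∀ i →
                sum (λ y → ∑ᶠ (λ π → F (π [ i ≔ y ]))) ≈ ι q * ∑ᶠ F
    ∑ᶠ-update {q} {suc n} F ext zero = begin
      sum (λ y → sum {q} (λ z → ∑ᶠ (λ π → F ((z ∷ π) [ zero ≔ y ]))))
        ≈⟨ sum-cong {q} (λ y → sum-cong-≋ {q} λ z → ∑ᶠ-cong {q} {n} λ π → ext λ { zero → ≡.refl ; (suc i) → ≡.refl }) ⟩
      sum (λ y → sum {q} (λ z → ∑ᶠ (λ π → F (y ∷ π))))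
        ≈⟨ sum-cong {q} (λ y → sum-const q _) ⟩
      sum (λ y → ι q * ∑ᶠ (λ π → F (y ∷ π)))
        ≈⟨ *-distribˡ-sum (ι q) (λ y → ∑ᶠ (λ π → F (y ∷ π))) ⟨
      ι q * ∑ᶠ F  ∎
    ∑ᶠ-update {q} {suc n} F ext (suc i) = begin
      sum (λ y → sum (λ z → ∑ᶠ (λ π → F ((z ∷ π) [ suc i ≔ y ]))))
        ≈⟨ ∑-comm {q} {q} (λ y z → ∑ᶠ (λ π → F ((z ∷ π) [ suc i ≔ y ]))) ⟩
      sum (λ z → sum (λ y → ∑ᶠ (λ π → F ((z ∷ π) [ suc i ≔ y ]))))
        ≈⟨ sum-cong {q} (λ z → sum-cong-≋ {q} λ y → ∑ᶠ-cong {q} {n} λ π → ext λ { zero → ≡.refl ; (suc j) → ≡.refl }) ⟩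
      sum (λ z → sum (λ y → ∑ᶠ (λ π → F (z ∷ (π [ i ≔ y ])))))
        ≈⟨ sum-cong {q} (λ z → ∑ᶠ-update (λ π → F (z ∷ π)) (λ e → ext (∷-cong z e)) i) ⟩
      sum (λ z → ι q * ∑ᶠ (λ π → F (z ∷ π)))
        ≈⟨ *-distribˡ-sum (ι q) (λ y → ∑ᶠ (λ π → F (y ∷ π))) ⟨
      ι q * ∑ᶠ F  ∎

module SpinSystem (ℛ : RealNumbers) where
  open RealNumbers ℛ
  open OrderedField ℛ
  open Sums ℛ

  module Products where

    product-single : ∀ {n} (j : Fin n) (f : Vector ℝ n) →
                     product (λ i → if does (i Fin.≟ j) then f i else 1#) ≈ f j
    product-single {suc n} zero f = trans (*-congˡ (product-one {n} λ i → refl)) (*-identityʳ _)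
    product-single {suc n} (suc j) f = trans (*-identityˡ _)
      (trans (product-cong {n} same) (product-single j (f ∘ suc)))
      where
      same : ∀ i → (if does (suc i Fin.≟ suc j) then f (suc i) else 1#) ≈ (if does (i Fin.≟ j) then f (suc i) else 1#)
      same i with i Fin.≟ j
      ... | yes _ = refl
      ... | no  _ = refl

    ∑-count : ∀ {p a} {A : Set a} {P : Pred A p} (P? : Decidable P) {n} (f : Fin n → A) →
              ι (List.length (filter P? (tabulate f))) ≈ sum (λ i → 𝟙 (P? (f i)))
    ∑-count P? {zero}  f = refl
    ∑-count P? {suc n} f with P? (f zero)
    ... | yes _ = +-congˡ (∑-count P? (f ∘ suc))
    ... | no  _ = trans (∑-count P? (f ∘ suc)) (sym (+-identityˡ _))

  -- The Potts weight as a function of directed messages.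

  module Messages (q : ℕ) (G : Graph)
                  (β : ℝ) (0<β : 0# < β) (β<1 : β < 1#) where
    open Products
    open Graph G using (Adj; Adj?; Adj-sym; Adj-irrefl; deg)
    open SetoidReasoning setoid

    private
      n = order G
      V = Vertex G

    -- m u w is the colour of u as seen by its neighbour w.
    Message : Set
    Message = V → V → Fin q

    θ : ℝ
    θ = 1# - β

    opaque
      -- The proposition is a parameter because the same factor is read over ordered pairs in `W`,
      -- where each edge counts once, and over plain adjacency in `localWeight`.
      φ : ∀ {A : Set} → Dec A → Fin q → Fin q → ℝ
      φ A? a b = if does A? then (if does (a Fin.≟ b) then β else 1#) else 1#

      φ-pos : ∀ {A : Set} (A? : Dec A) a b → 0# < φ A? a b
      φ-pos (no  _) a b = 0<1
      φ-pos (yes _) a b with a Fin.≟ b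
      ... | yes _ = 0<β
      ... | no  _ = 0<1

      φ≤1 : ∀ {A : Set} (A? : Dec A) a b → φ A? a b ≤ 1#
      φ≤1 (no  _) a b = ≤-refl
      φ≤1 (yes _) a b with a Fin.≟ b
      ... | yes _ = inj₁ β<1
      ... | no  _ = ≤-refl

      β≤φ : ∀ {A : Set} (A? : Dec A) a b → β ≤ φ A? a b
      β≤φ (no  _) a b = inj₁ β<1
      β≤φ (yes _) a b with a Fin.≟ b
      ... | yes _ = ≤-refl
      ... | no  _ = inj₁ β<1

      φ-no : ∀ {A : Set} (A? : Dec A) → ¬ A → ∀ a b → φ A? a b ≈ 1#
      φ-no (no  _) ¬a _ _ = refl
      φ-no (yes a) ¬a _ _ = contradiction a ¬a

      φ-≢ : ∀ {A : Set} (A? : Dec A) {a b} → a ≢ b → φ A? a b ≈ 1#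
      φ-≢ (no  _) a≢b = refl
      φ-≢ (yes _) {a} {b} a≢b with a Fin.≟ b
      ... | yes a≡b = contradiction a≡b a≢b
      ... | no  _   = refl

      φ-cong : ∀ {A B : Set} (A? : Dec A) (B? : Dec B) → (A → B) → (B → A) → ∀ a b → φ A? a b ≈ φ B? a b
      φ-cong (yes a) (yes b) f g _ _ = refl
      φ-cong (no ¬a) (no ¬b) f g _ _ = refl
      φ-cong (yes a) (no ¬b) f g _ _ = contradiction (f a) ¬b
      φ-cong (no ¬a) (yes b) f g _ _ = contradiction (g b) ¬a

      φ-cong₂ : ∀ {A : Set} (A? : Dec A) {a b a′ b′} → (A → a ≡ a′) → (A → b ≡ b′) → φ A? a b ≈ φ A? a′ b′
      φ-cong₂ (no _)  p r = refl
      φ-cong₂ (yes e) p r with ≡.refl ← p e | ≡.refl ← r e = refl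

      φ-sym : ∀ {A : Set} (A? : Dec A) a b → φ A? a b ≈ φ A? b a
      φ-sym (no  _) a b = refl
      φ-sym (yes _) a b with a Fin.≟ b | b Fin.≟ a
      ... | yes _ | yes _ = refl
      ... | no  _ | no  _ = refl
      ... | yes p | no ¬p = contradiction (≡.sym p) ¬p
      ... | no ¬p | yes p = contradiction (≡.sym p) ¬p

      1-φ : ∀ {A : Set} (A? : Dec A) a b → 1# - φ A? a b ≈ 𝟙 (b Fin.≟ a) * (𝟙 A? * θ)
      1-φ (no  _) a b = trans (-‿inverseʳ 1#) (sym (trans (*-congˡ (zeroˡ θ)) (zeroʳ _)))
      1-φ (yes _) a b with a Fin.≟ b | b Fin.≟ a
      ... | yes _ | yes _ = sym (trans (*-identityˡ _) (*-identityˡ θ))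
      ... | no  _ | no  _ = trans (-‿inverseʳ 1#) (sym (zeroˡ _))
      ... | yes p | no ¬p = contradiction (≡.sym p) ¬p
      ... | no ¬p | yes p = contradiction (≡.sym p) ¬p

    pair? : ∀ u v → Dec (u Fin.< v × Adj u v)
    pair? u v = (u Fin.<? v) ×-dec Adj? u v

    pairWeight : Message → V → V → ℝ
    pairWeight m u v = φ (pair? u v) (m u v) (m v u)

    W : Message → ℝ
    W m = product λ u → product λ v → pairWeight m u v

    localWeight : V → Message → V → ℝ
    localWeight w m u = φ (Adj? w u) (m u w) (m w u)

    away : V → Message → V → V → ℝ
    away w m u v = if does (u Fin.≟ w) then 1# else
                   if does (v Fin.≟ w) then 1# else pairWeight m u v

    remoteWeight : V → Message → ℝ
    remoteWeight w m = product λ u → product λ v → away w m u v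

    W-pos : ∀ m → 0# < W m
    W-pos m = product-pos λ u → product-pos λ v → φ-pos (pair? u v) _ _

    remoteWeight-nonneg : ∀ w m → 0# ≤ remoteWeight w m
    remoteWeight-nonneg w m = product-nonneg λ u → product-nonneg (nonneg u)
      where
      nonneg : ∀ u v → 0# ≤ away w m u v
      nonneg u v with u Fin.≟ w | v Fin.≟ w
      ... | yes _ | _     = 0≤1
      ... | no  _ | yes _ = 0≤1
      ... | no  _ | no  _ = inj₁ (φ-pos (pair? u v) _ _)

    W-cong : ∀ {m m′} → (∀ u v → Adj u v → m u v ≡ m′ u v) → W m ≈ W m′
    W-cong p = product-cong {n} λ u → product-cong {n} λ v →
      φ-cong₂ (pair? u v) (p u v ∘ proj₂) (p v u ∘ Adj-sym ∘ proj₂)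

    remoteWeight-cong : ∀ w {m m′} → (∀ u v → u ≢ w → v ≢ w → m u v ≡ m′ u v) →
                        remoteWeight w m ≈ remoteWeight w m′
    remoteWeight-cong w {m} {m′} p = product-cong {n} λ u → product-cong {n} (same u)
      where
      same : ∀ u v → away w m u v ≈ away w m′ u v
      same u v with u Fin.≟ w | v Fin.≟ w
      ... | yes _   | _       = refl
      ... | no  _   | yes _   = refl
      ... | no  u≢w | no  v≢w = reflexive (≡.cong₂ (φ (pair? u v)) (p u v u≢w v≢w) (p v u v≢w u≢w))

    -- The factors at `w` fill row `w` and column `w`. For each neighbour only the position with the
    -- smaller vertex first is nontrivial, so the two merge into one `localWeight`.
    W-split : ∀ w m → W m ≈ product (localWeight w m) * remoteWeight w m
    W-split w m = begin
      product (λ u → product λ v → p u v)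
        ≈⟨ product-cong {n} (λ u → product-cong {n} λ v → factor u v) ⟩
      product (λ u → product λ v → (a u v * b u v) * r u v)
        ≈⟨ product-cong {n} (λ u → trans (∏-distrib-* (λ v → a u v * b u v) (r u)) (*-congʳ (∏-distrib-* (a u) (b u)))) ⟩
      product (λ u → (product (a u) * product (b u)) * product (r u))
        ≈⟨ trans (∏-distrib-* (λ u → product (a u) * product (b u)) (λ u → product (r u))) (*-congʳ (∏-distrib-* (λ u → product (a u)) (λ u → product (b u)))) ⟩
      (product (λ u → product (a u)) * product (λ u → product (b u))) * remoteWeight w m
        ≈⟨ *-congʳ (*-cong (trans (product-cong {n} row) (product-single w λ u → product (p u))) (product-cong {n} λ u → product-single w (p u))) ⟩
      (product (p w) * product (λ u → p u w)) * remoteWeight w m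
        ≈⟨ *-congʳ (∏-distrib-* (p w) (λ u → p u w)) ⟨
      product (λ u → p w u * p u w) * remoteWeight w m
        ≈⟨ *-congʳ (product-cong {n} merge) ⟩
      product (localWeight w m) * remoteWeight w m ∎
      where
      p a b r : V → V → ℝ
      p = pairWeight m
      a u v = if does (u Fin.≟ w) then p u v else 1#
      b u v = if does (v Fin.≟ w) then p u v else 1#
      r = away w m

      factor : ∀ u v → p u v ≈ (a u v * b u v) * r u v
      factor u v with u Fin.≟ w | v Fin.≟ w
      ... | yes _ | no  _ = sym (trans (*-identityʳ _) (*-identityʳ _))
      ... | no  _ | yes _ = sym (trans (*-identityʳ _) (*-identityˡ _))
      ... | no  _ | no  _ = sym (trans (*-congʳ (*-identityˡ _)) (*-identityˡ _))
      ... | yes ≡.refl | yes ≡.refl = trans loop (sym (trans (*-identityʳ _) (trans (*-cong loop loop) (*-identityˡ _))))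
        where loop = φ-no (pair? w w) (λ e → Fin.<-irrefl ≡.refl (proj₁ e)) (m w w) (m w w)

      row : ∀ u → product (a u) ≈ (if does (u Fin.≟ w) then product (p u) else 1#)
      row u with u Fin.≟ w
      ... | yes _ = refl
      ... | no  _ = product-one {n} λ _ → refl

      merge : ∀ u → p w u * p u w ≈ localWeight w m u
      merge u with Fin.<-cmp w u
      ... | tri< w<u _ u≮w = trans
        (*-cong (trans (φ-sym (pair? w u) _ _) (φ-cong (pair? w u) (Adj? w u) proj₂ (w<u ,_) _ _))
                (φ-no (pair? u w) (u≮w ∘ proj₁) _ _))
        (*-identityʳ _)
      ... | tri> w≮u _ u<w = trans
        (*-cong (φ-no (pair? w u) (w≮u ∘ proj₁) _ _)
                (φ-cong (pair? u w) (Adj? w u) (Adj-sym ∘ proj₂) (λ e → u<w , Adj-sym e) _ _))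
        (*-identityˡ _)
      ... | tri≈ w≮u ≡.refl _ = trans
        (*-cong (φ-no (pair? w w) (w≮u ∘ proj₁) _ _) (φ-no (pair? w w) (w≮u ∘ proj₁) _ _))
        (trans (*-identityˡ 1#) (sym (φ-no (Adj? w w) (Adj-irrefl ≡.refl) _ _)))

    -- Only the message `f → w` differs, and it enters only the factor of the pair `f`, `w`; the
    -- ratio of the weights is the ratio of these factors.
    W-exchange : ∀ f w {m m′} → f ≢ w → (∀ u v → u ≢ f ⊎ v ≢ w → m u v ≡ m′ u v) →
                 W m * localWeight w m′ f ≈ W m′ * localWeight w m f
    W-exchange f w {m} {m′} f≢w p = begin
      W m * localWeight w m′ f
        ≈⟨ *-congʳ (W-split w m) ⟩
      product (localWeight w m) * remoteWeight w m * localWeight w m′ f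
        ≈⟨ swap _ _ _ ⟩
      product (localWeight w m) * localWeight w m′ f * remoteWeight w m
        ≈⟨ *-cong (product-exchange (localWeight w m) (localWeight w m′) f sameLocal)
                  (remoteWeight-cong w λ u v _ v≢w → p u v (inj₂ v≢w)) ⟩
      product (localWeight w m′) * localWeight w m f * remoteWeight w m′
        ≈⟨ swap _ _ _ ⟩
      product (localWeight w m′) * remoteWeight w m′ * localWeight w m f
        ≈⟨ *-congʳ (W-split w m′) ⟨
      W m′ * localWeight w m f ∎
      where
      swap : ∀ x y z → x * y * z ≈ x * z * y
      swap = solve 3 (λ x y z → x :* y :* z := x :* z :* y) refl

      sameLocal : ∀ u → u ≢ f → localWeight w m u ≈ localWeight w m′ u
      sameLocal u u≢f = reflexive
        (≡.cong₂ (φ (Adj? w u)) (p u w (inj₁ u≢f)) (p w u (inj₁ (f≢w ∘ ≡.sym))))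

    -- For fixed `y` the product is at least 1 minus its deficits. Neighbour `u` has a deficit only
    -- at the colour `c u`, of size `θ`, so over all `y` the deficits add up to `deg w * θ`.
    ∑-local-lower-bound : ∀ w (c : V → Fin q) →
      ι q ≤ sum (λ y → product (λ u → φ (Adj? w u) (c u) y)) + ι (deg w) * θ
    ∑-local-lower-bound w c = ≤-resp (trans (sum-const q 1#) (*-identityʳ _))
      (trans (∑-distrib-+ (λ y → product (l y)) (λ y → sum (λ u → 1# - l y u))) (+-congˡ total))
      (sum-mono {q} λ y → bernoulli {n} {l y} (λ u → inj₁ (φ-pos (Adj? w u) _ _)) (λ u → φ≤1 (Adj? w u) _ _))
      where
      l : Fin q → V → ℝ
      l y u = φ (Adj? w u) (c u) y

      total : sum (λ y → sum (λ u → 1# - l y u)) ≈ ι (deg w) * θ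
      total = begin
        sum (λ y → sum (λ u → 1# - l y u))
          ≈⟨ ∑-comm {q} {n} (λ y u → 1# - l y u) ⟩
        sum (λ u → sum (λ y → 1# - l y u))
          ≈⟨ sum-cong {n} (λ u → sum-cong {q} λ y → 1-φ (Adj? w u) (c u) y) ⟩
        sum (λ u → sum (λ y → 𝟙 (y Fin.≟ c u) * (𝟙 (Adj? w u) * θ)))
          ≈⟨ sum-cong {n} (λ u → trans (sum-𝟙 (c u) (λ _ → 𝟙 (Adj? w u) * θ)) (*-comm _ _)) ⟩
        sum (λ u → θ * 𝟙 (Adj? w u))
          ≈⟨ *-distribˡ-sum θ (λ u → 𝟙 (Adj? w u)) ⟨
        θ * sum (λ u → 𝟙 (Adj? w u))
          ≈⟨ *-congˡ (∑-count (Adj? w) (λ u → u)) ⟨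
        θ * ι (deg w)
          ≈⟨ *-comm _ _ ⟩
        ι (deg w) * θ ∎

    -- The vertices in A act through the fixed messages s; their own colours no longer matter but are
    -- still summed over, which cancels in the marginals.
    msg : (V → Bool) → Message → (V → Fin q) → Message
    msg A s π u v = if A u then s u v else π u

    T : ((V → Fin q) → ℝ) → (V → Bool) → Message → ℝ
    T ψ A s = ∑ᶠ λ π → ψ π * W (msg A s π)

    msg-extensional : ∀ A s {π ρ} → π ≗ ρ → ∀ u v → msg A s π u v ≡ msg A s ρ u v
    msg-extensional A s e u v with A u
    ... | true  = ≡.refl
    ... | false = e u

    T-proportional : ∀ ψ A s A′ s′ {c c′} → (∀ π → W (msg A s π) * c′ ≈ W (msg A′ s′ π) * c) →
                     T ψ A s * c′ ≈ T ψ A′ s′ * c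
    T-proportional ψ A s A′ s′ {c} {c′} p = begin
      T ψ A s * c′
        ≈⟨ trans (*-comm _ _) (*-distribˡ-∑ᶠ c′ λ π → ψ π * W (msg A s π)) ⟩
      ∑ᶠ (λ π → c′ * (ψ π * W (msg A s π)))
        ≈⟨ ∑ᶠ-cong (λ π → trans (rotate _ _ _) (trans (*-congˡ (p π)) (sym (rotate _ _ _)))) ⟩
      ∑ᶠ (λ π → c * (ψ π * W (msg A′ s′ π)))
        ≈⟨ trans (*-comm _ _) (*-distribˡ-∑ᶠ c λ π → ψ π * W (msg A′ s′ π)) ⟨
      T ψ A′ s′ * c ∎
      where
      rotate : ∀ a b c → a * (b * c) ≈ b * (c * a)
      rotate = solve 3 (λ a b c → a :* (b :* c) := b :* (c :* a)) refl

    msg-cong : ∀ A s s′ {u v} → (A u ≡ true → s u v ≡ s′ u v) → ∀ π → msg A s π u v ≡ msg A s′ π u v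
    msg-cong A s s′ {u} p π with A u in eq
    ... | true  = p ≡.refl
    ... | false = ≡.refl

    T-cong : ∀ ψ A {s s′} → (∀ u v → A u ≡ true → Adj u v → s u v ≡ s′ u v) → T ψ A s ≈ T ψ A s′
    T-cong ψ A {s} {s′} p = ∑ᶠ-cong λ π → *-congˡ (W-cong λ u v e → msg-cong A s s′ (λ Au → p u v Au e) π)

    msg-visit : ∀ {A s w} → A w ≡ false → ∀ π y u v →
                msg A s (π [ w ≔ y ]) u v ≡ msg (A [ w ≔ true ]) (s [ w ≔ const y ]) π u v
    msg-visit {A} {s} {w} Aw π y u v with u Fin.≟ w
    ... | yes ≡.refl rewrite Aw | updateAt-updates w {const true} A | updateAt-updates w {const (const y)} s
        = updateAt-updates w π
    ... | no u≢w rewrite updateAt-minimal u w {const true} A u≢w | updateAt-minimal u w {const (const y)} s u≢w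
                       | updateAt-minimal u w {const y} π u≢w = ≡.refl

    -- Conditioning on the colour of `w`: it becomes the constant message `y`. The factor `q` comes
    -- from the old colour of `w`, which is still summed over after freezing.
    T-visit : ∀ ψ → Extensional ψ → ∀ {A} s {w} → A w ≡ false →
              sum (λ y → T (λ π → ψ (π [ w ≔ y ])) (A [ w ≔ true ]) (s [ w ≔ const y ])) ≈ ι q * T ψ A s
    T-visit ψ ext {A} s {w} Aw = trans
      (sum-cong {q} λ y → ∑ᶠ-cong λ π → *-congˡ (W-cong λ u v _ → ≡.sym (msg-visit {A} {s} Aw π y u v)))
      (∑ᶠ-update (λ π → ψ π * W (msg A s π)) (λ e → *-cong (ext e) (W-cong λ u v _ → msg-extensional A s e u v)) w)

  -- Changing a distribution at one exceptional point.

  module Tilting where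
    open SetoidReasoning setoid

    -- Away from `b` the coefficients are nonnegative, so `X y` may be replaced by `C = X b + M`.
    -- The constant `C` contributes nothing since `t` sums to zero, and the excess charged at `b` is
    -- `- t b * M`.
    signed-sum-≤ : ∀ {q} (t X : Fin q → ℝ) b {M} → sum t ≈ 0# → (∀ y → y ≢ b → 0# ≤ t y) →
                   (∀ y → X y ≤ X b + M) → sum (λ y → t y * X y) ≤ - t b * M
    signed-sum-≤ {q} t X b {M} ∑t≈0 t≥0 X≤ = ≤-respʳ total (sum-mono {q} pointwise)
      where
      C = X b + M

      pointwise : ∀ y → t y * X y ≤ C * t y + 𝟙 (y Fin.≟ b) * (- (t y * M))
      pointwise y with y Fin.≟ b
      ... | yes ≡.refl = ≤-reflexive
        (solve 3 (λ t X M → t :* X := (X :+ M) :* t :+ 𝟏 :* (:- (t :* M))) refl (t y) (X y) M)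
      ... | no  y≢b = ≤-respʳ
        (solve 3 (λ t C M → t :* C := C :* t :+ 𝟎 :* (:- (t :* M))) refl (t y) C M)
        (*-monoˡ (t≥0 y y≢b) (X≤ y))

      total : sum (λ y → C * t y + 𝟙 (y Fin.≟ b) * (- (t y * M))) ≈ - t b * M
      total = begin
        sum (λ y → C * t y + 𝟙 (y Fin.≟ b) * (- (t y * M)))
          ≈⟨ ∑-distrib-+ (λ y → C * t y) (λ y → 𝟙 (y Fin.≟ b) * (- (t y * M))) ⟩
        sum (λ y → C * t y) + sum (λ y → 𝟙 (y Fin.≟ b) * (- (t y * M)))
          ≈⟨ +-cong (trans (sym (*-distribˡ-sum C t)) (*-congˡ ∑t≈0)) (sum-𝟙 b (λ y → - (t y * M))) ⟩
        C * 0# + - (t b * M)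
          ≈⟨ solve 3 (λ C t M → C :* 𝟎 :+ :- (t :* M) := :- t :* M) refl C (t b) M ⟩
        - t b * M ∎

    sum-tilt : ∀ {q} (A B X : Fin q → ℝ) (α β : ℝ) →
               sum (λ y → (B y * α - A y * β) * X y) ≈
               sum (λ y → B y * X y) * α - sum (λ y → A y * X y) * β
    sum-tilt {q} A B X α β = begin
      sum (λ y → (B y * α - A y * β) * X y)
        ≈⟨ sum-cong {q} (λ y → solve 5 (λ A B X α β → (B :* α :- A :* β) :* X := α :* (B :* X) :+ (:- β) :* (A :* X)) refl (A y) (B y) (X y) α β) ⟩
      sum (λ y → α * (B y * X y) + - β * (A y * X y))
        ≈⟨ ∑-distrib-+ (λ y → α * (B y * X y)) (λ y → - β * (A y * X y)) ⟩
      sum (λ y → α * (B y * X y)) + sum (λ y → - β * (A y * X y))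
        ≈⟨ +-cong (*-distribˡ-sum α (λ y → B y * X y)) (*-distribˡ-sum (- β) (λ y → A y * X y)) ⟨
      α * sum (λ y → B y * X y) + - β * sum (λ y → A y * X y)
        ≈⟨ solve 4 (λ a b α β → α :* b :+ (:- β) :* a := b :* α :- a :* β) refl _ _ α β ⟩
      sum (λ y → B y * X y) * α - sum (λ y → A y * X y) * β ∎

    -- After normalising A and B, the probability can drop from A to B only at b, and there by at
    -- most 1 - β times the probability of b under A; this is the total variation distance.
    tilted-≤ : ∀ {q} (A B X : Fin q → ℝ) b {β M Δ D} →
               (∀ y → 0# ≤ A y) → 0# < sum A → 0# ≤ sum B → sum B ≤ sum A →
               0# ≤ β → β ≤ 1# → 0# ≤ M →
               (∀ y → y ≢ b → A y ≤ B y) → β * A b ≤ B b →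
               A b * ι q ≤ sum A + D * A b →
               (∀ κ → 0# ≤ κ → κ ≤ 1# → κ * ι q ≤ (1# - β) + κ * D → κ ≤ Δ) →
               (∀ y → X y ≤ X b + M) →
               sum (λ y → B y * X y) * sum A - sum (λ y → A y * X y) * sum B ≤ Δ * M * (sum A * sum B)
    tilted-≤ {q} A B X b {β} {M} {Δ} {D} 0≤A 0<α 0≤γ γ≤α 0≤β β≤1 0≤M A≤B βA≤B bound Δ-bound X≤ =
      ≤-respˡ (sum-tilt A B X α γ) (≤-trans (signed-sum-≤ t X b ∑t≈0 t≥0 X≤) (≤-trans (*-monoʳ 0≤M -t≤) final))
      where
      α = sum A
      γ = sum B
      t = λ y → B y * α - A y * γ
      -- Bounds the drop at `b`. Multiplying `bound` by `1 - β` and dividing by `α` turns it into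
      -- the premise of `Δ-bound` for this `κ`.
      κ = ((1# - β) * A b) / α

      ακ : α * κ ≈ (1# - β) * A b
      ακ = *-/-cancel _ 0<α

      0≤θ : 0# ≤ 1# - β
      0≤θ = x≤y⇒0≤y-x β≤1

      ∑t≈0 : sum t ≈ 0#
      ∑t≈0 = begin
        sum t
          ≈⟨ sum-cong {q} (λ y → *-identityʳ (t y)) ⟨
        sum (λ y → t y * 1#)
          ≈⟨ sum-tilt A B (λ _ → 1#) α γ ⟩
        sum (λ y → B y * 1#) * α - sum (λ y → A y * 1#) * γ
          ≈⟨ +-cong (*-congʳ (sum-cong {q} λ y → *-identityʳ (B y))) (-‿cong (*-congʳ (sum-cong {q} λ y → *-identityʳ (A y)))) ⟩
        γ * α - α * γ
          ≈⟨ solve 2 (λ α γ → γ :* α :- α :* γ := 𝟎) refl α γ ⟩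
        0# ∎

      t≥0 : ∀ y → y ≢ b → 0# ≤ t y
      t≥0 y y≢b = x≤y⇒0≤y-x (*-mono-≤ (0≤A y) (A≤B y y≢b) 0≤γ γ≤α)

      κ≤Δ : κ ≤ Δ
      κ≤Δ = Δ-bound κ (/-nonneg (*-nonneg 0≤θ (0≤A b)) 0<α)
        (/-≤ 0<α (≤-trans (*-monoʳ (0≤A b) (≤-by β 0≤β (solve 1 (λ β → (𝟏 :- β) :+ β := 𝟏) refl β)))
          (*-monoˡ 0≤1 (term≤sum 0≤A b))))
        (*-cancelˡ-≤ 0<α (≤-resp
          (trans (sym (*-assoc _ _ _)) (trans (*-congʳ (sym ακ)) (*-assoc _ _ _)))
          (trans (solve 4 (λ θ α D a → θ :* (α :+ D :* a) := θ :* α :+ (θ :* a) :* D) refl (1# - β) α D (A b))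
            (trans (+-congˡ (*-congʳ (sym ακ)))
              (solve 4 (λ θ α κ D → θ :* α :+ (α :* κ) :* D := α :* (θ :+ κ :* D)) refl (1# - β) α κ D)))
          (*-monoˡ 0≤θ bound)))

      -t≤ : - t b ≤ Δ * (α * γ)
      -t≤ = ≤-trans
        -- `A b * γ - B b * α ≤ (1 - β) * A b * γ`: the first summand of the slack replaces `B b` by
        -- `β * A b`, the second replaces `α` by `γ`.
        (≤-by ((B b - β * A b) * α + β * A b * (α - γ))
          (+-nonneg (*-nonneg (x≤y⇒0≤y-x βA≤B) (inj₁ 0<α)) (*-nonneg (*-nonneg 0≤β (0≤A b)) (x≤y⇒0≤y-x γ≤α)))
          (trans (solve 5 (λ A B α γ β → :- (B :* α :- A :* γ) :+ ((B :- β :* A) :* α :+ β :* A :* (α :- γ))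
                            := ((𝟏 :- β) :* A) :* γ) refl (A b) (B b) α γ β)
            (*-congʳ (sym ακ))))
        (≤-resp (solve 3 (λ α κ γ → κ :* (α :* γ) := α :* κ :* γ) refl α κ γ) refl
          (*-monoʳ (*-nonneg (inj₁ 0<α) 0≤γ) κ≤Δ))

      final : Δ * (α * γ) * M ≤ Δ * M * (α * γ)
      final = ≤-reflexive (solve 3 (λ Δ S M → Δ :* S :* M := Δ :* M :* S) refl Δ (α * γ) M)

  -- Marginals with frozen vertices, and the effect of a single message.

  module Marginals (q : ℕ) (y₀ : Fin q) (G : Graph)
                   (β : ℝ) (0<β : 0# < β) (β<1 : β < 1#) (v : Vertex G) (x : Fin q) where
    open Tilting
    open Messages q G β 0<β β<1
    open Graph G using (Adj?; Adj-irrefl; deg)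
    open SetoidReasoning setoid

    private
      n = order G
      V = Vertex G

    one target : (V → Fin q) → ℝ
    one    π = 1#
    target π = 𝟙 (π v Fin.≟ x)

    target-extensional : Extensional target
    target-extensional e = reflexive (≡.cong (λ z → 𝟙 (z Fin.≟ x)) (e v))

    Z N Pr : (V → Bool) → Message → ℝ
    Z = T one
    N = T target
    Pr A s = N A s / Z A s

    Z-pos : ∀ A s → 0# < Z A s
    Z-pos A s = <-≤-trans (*-pos 0<1 (W-pos (msg A s (const y₀))))
      (term≤∑ᶠ {F = λ π → 1# * W (msg A s π)} (λ e → *-congˡ (W-cong λ u v _ → msg-extensional A s e u v))
        (λ π → inj₁ (*-pos 0<1 (W-pos _))) (const y₀))

    Pr-nonneg : ∀ A s → 0# ≤ Pr A s
    Pr-nonneg A s = /-nonneg (∑ᶠ-nonneg λ π → *-nonneg (0≤𝟙 (π v Fin.≟ x)) (inj₁ (W-pos _))) (Z-pos A s)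

    Pr≤1 : ∀ A s → Pr A s ≤ 1#
    Pr≤1 A s = /-≤ (Z-pos A s) (≤-respʳ (sym (*-identityˡ _))
      (∑ᶠ-mono λ π → *-monoʳ (inj₁ (W-pos _)) (𝟙≤1 (π v Fin.≟ x))))

    Pr-cong : ∀ {A s A′ s′} → Z A s ≈ Z A′ s′ → N A s ≈ N A′ s′ → Pr A s ≈ Pr A′ s′
    Pr-cong {A} {s} {A′} {s′} p r = /-unique (Z-pos A′ s′)
      (trans (*-congʳ (sym p)) (trans (*-/-cancel _ (Z-pos A s)) r))

    visit : (V → Bool) → V → V → Bool
    visit A w = A [ w ≔ true ]

    see : Message → V → Fin q → Message
    see s w y = s [ w ≔ const y ]

    msg-see : ∀ A s w y π u → msg (visit A w) (see s w y) π w u ≡ y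
    msg-see A s w y π u rewrite updateAt-updates w {const true} A | updateAt-updates w {const (const y)} s = ≡.refl

    msg-away : ∀ A s w y π {u} z → u ≢ w → msg (visit A w) (see s w y) π u z ≡ msg A s π u z
    msg-away A s w y π {u} z u≢w
      rewrite updateAt-minimal u w {const true} A u≢w | updateAt-minimal u w {const (const y)} s u≢w = ≡.refl

    visited : ∀ {A} s {u} → A u ≡ true → ∀ π z → msg A s π u z ≡ s u z
    visited s Au π z rewrite Au = ≡.refl

    -- Once `w` is frozen along with `f`, the factor of this pair is the same for all colourings and
    -- leaves the sum.
    T-exchange : ∀ ψ {A s s′ f w} → A f ≡ true → A w ≡ false →
      (∀ u z → u ≢ f ⊎ z ≢ w → s u z ≡ s′ u z) → ∀ y →
      T ψ (visit A w) (see s w y) * φ (Adj? w f) (s′ f w) y ≈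
      T ψ (visit A w) (see s′ w y) * φ (Adj? w f) (s f w) y
    T-exchange ψ {A} {s} {s′} {f} {w} Af Aw p y =
      T-proportional ψ (visit A w) (see s w y) (visit A w) (see s′ w y) λ π → trans (*-congˡ (sym (local s′ π)))
        (trans (W-exchange f w f≢w (agree π)) (*-congˡ (local s π)))
      where
      m : Message → (V → Fin q) → Message
      m s = msg (visit A w) (see s w y)

      f≢w : f ≢ w
      f≢w ≡.refl with () ← ≡.trans (≡.sym Af) Aw

      local : ∀ s π → localWeight w (m s π) f ≈ φ (Adj? w f) (s f w) y
      local s π = reflexive (≡.cong₂ (φ (Adj? w f))
        (≡.trans (msg-away A s w y π w f≢w) (visited {A} s Af π w)) (msg-see A s w y π f))

      agree : ∀ π u z → u ≢ f ⊎ z ≢ w → m s π u z ≡ m s′ π u z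
      agree π u z d with u Fin.≟ w
      ... | yes ≡.refl = ≡.trans (msg-see A s w y π z) (≡.sym (msg-see A s′ w y π z))
      ... | no  u≢w = ≡.trans (msg-away A s w y π z u≢w)
        (≡.trans (msg-cong A s s′ (λ _ → p u z d) π) (≡.sym (msg-away A s′ w y π z u≢w)))

    -- A message between two frozen vertices scales `Z` and `N` alike. This is what keeps the walks
    -- self-avoiding.
    Pr-visited : ∀ {A s s′ f w} → A f ≡ true → A w ≡ true → f ≢ w →
      (∀ u z → u ≢ f ⊎ z ≢ w → s u z ≡ s′ u z) → Pr A s ≈ Pr A s′
    Pr-visited {A} {s} {s′} {f} {w} Af Aw f≢w p = /-unique (Z-pos A s′) (*-cancelˡ-≈ (φ-pos (Adj? w f) _ _) (begin
      c * (Z A s′ * Pr A s)    ≈⟨ solve 3 (λ c z p → c :* (z :* p) := z :* c :* p) refl _ _ _ ⟩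
      Z A s′ * c * Pr A s      ≈⟨ *-congʳ (scale one) ⟨
      Z A s * c′ * Pr A s      ≈⟨ solve 3 (λ c z p → z :* c :* p := z :* p :* c) refl _ _ _ ⟩
      Z A s * Pr A s * c′      ≈⟨ *-congʳ (*-/-cancel _ (Z-pos A s)) ⟩
      N A s * c′               ≈⟨ scale target ⟩
      N A s′ * c               ≈⟨ *-comm _ _ ⟩
      c * N A s′               ∎))
      where
      c c′ : ℝ
      c  = φ (Adj? w f) (s f w) (s w f)
      c′ = φ (Adj? w f) (s′ f w) (s′ w f)

      local : ∀ s π → localWeight w (msg A s π) f ≈ φ (Adj? w f) (s f w) (s w f)
      local s π = reflexive (≡.cong₂ (φ (Adj? w f)) (visited {A} s Af π w) (visited {A} s Aw π f))

      scale : ∀ ψ → T ψ A s * c′ ≈ T ψ A s′ * c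
      scale ψ = T-proportional ψ A s A s′ λ π → trans (*-congˡ (sym (local s′ π)))
        (trans (W-exchange f w f≢w λ u z d → msg-cong A s s′ (λ _ → p u z d) π) (*-congˡ (local s π)))

    -- In terms of probabilities, colour `y` at `w` has probability at most `1 / (q - θ deg w)`. It
    -- is multiplied out because the denominator may fail to be positive, and is then immediate.
    -- Otherwise compare for each colouring of the rest: the local weight of `y` is at most 1, those
    -- of all colours add up to at least the denominator, and the remote factor is common.
    Z-visit-bound : ∀ A s w y →
      Z (visit A w) (see s w y) * ι q ≤
      sum (λ z → Z (visit A w) (see s w z)) + ι (deg w) * θ * Z (visit A w) (see s w y)
    Z-visit-bound A s w y with ≤-total 0# (ι q - ι (deg w) * θ)
    ... | inj₂ D≤0 = ≤-by
        (sum (λ z → Z (visit A w) (see s w z)) + Zy * (0# - D))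
        (+-nonneg (sum-nonneg {q} λ z → inj₁ (Z-pos (visit A w) (see s w z))) (*-nonneg (inj₁ (Z-pos (visit A w) (see s w y))) (x≤y⇒0≤y-x D≤0)))
        (solve 4 (λ Z q S d → Z :* q :+ (S :+ Z :* (𝟎 :- (q :- d))) := S :+ d :* Z) refl Zy (ι q) _ (ι (deg w) * θ))
      where
      D  = ι q - ι (deg w) * θ
      Zy = Z (visit A w) (see s w y)
    ... | inj₁ 0≤D = ≤-by (sum Zᵥ - Zᵥ y * D) (x≤y⇒0≤y-x ZD≤)
        (solve 4 (λ Z q S d → Z :* q :+ (S :- Z :* (q :- d)) := S :+ d :* Z) refl (Zᵥ y) (ι q) (sum Zᵥ) (ι (deg w) * θ))
      where
      D  = ι q - ι (deg w) * θ
      Zᵥ = λ z → Z (visit A w) (see s w z)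

      l : (V → Fin q) → Fin q → ℝ
      l π z = product (λ u → φ (Adj? w u) (msg A s π u w) z)

      ρ : (V → Fin q) → ℝ
      ρ π = remoteWeight w (msg A s π)

      local : ∀ π z u → localWeight w (msg (visit A w) (see s w z) π) u ≈ φ (Adj? w u) (msg A s π u w) z
      local π z u with u Fin.≟ w
      ... | yes ≡.refl = trans (φ-no (Adj? w w) (Adj-irrefl ≡.refl) _ _) (sym (φ-no (Adj? w w) (Adj-irrefl ≡.refl) _ _))
      ... | no  u≢w = reflexive (≡.cong₂ (φ (Adj? w u)) (msg-away A s w z π w u≢w) (msg-see A s w z π u))

      expand : ∀ z → Zᵥ z ≈ ∑ᶠ (λ π → ρ π * l π z)
      expand z = ∑ᶠ-cong λ π → trans (*-identityˡ _) (trans (W-split w _) (trans (*-comm _ _)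
        (*-cong (remoteWeight-cong w (λ u u′ u≢w _ → msg-away A s w z π u′ u≢w)) (product-cong {n} (local π z)))))

      pointwise : ∀ π → D * (ρ π * l π y) ≤ ρ π * sum (l π)
      pointwise π = ≤-respˡ (solve 3 (λ D ρ l → ρ :* (D :* l) := D :* (ρ :* l)) refl D (ρ π) (l π y))
        (*-monoˡ (remoteWeight-nonneg w _) (≤-trans
          (≤-respʳ (*-identityʳ D) (*-monoˡ 0≤D (product≤1 {n} (λ u → inj₁ (φ-pos (Adj? w u) _ _)) (λ u → φ≤1 (Adj? w u) _ _))))
          (0≤y-x⇒x≤y (≤-respʳ (solve 3 (λ S d q → S :+ d :- q := S :- (q :- d)) refl _ _ _)
            (x≤y⇒0≤y-x (∑-local-lower-bound w (λ u → msg A s π u w)))))))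

      ZD≤ : Zᵥ y * D ≤ sum Zᵥ
      ZD≤ = ≤-resp
        (trans (sym (*-distribˡ-∑ᶠ D _)) (trans (*-congˡ (sym (expand y))) (*-comm D _)))
        (trans (∑ᶠ-cong λ π → *-distribˡ-sum (ρ π) (l π)) (trans (sym (∑-∑ᶠ-comm (λ z π → ρ π * l π z)))
          (sum-cong {q} λ z → sym (expand z))))
        (∑ᶠ-mono pointwise)

    -- The hypothesis says `δ d ≥ min(1, θ / (q - θ d))` when the denominator is positive and
    -- `δ d ≥ 1` otherwise; quantifying over `κ` avoids dividing by a quantity of unknown sign.
    module Contraction (δ : ℕ → ℝ)
      (δ-bound : ∀ d κ → 0# ≤ κ → κ ≤ 1# → κ * ι q ≤ (1# - β) + κ * (ι d * θ) → κ ≤ δ d) where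

      0<ιq : 0# < ι q
      0<ιq = positive y₀
        where
        positive : ∀ {k} → Fin k → 0# < ι k
        positive {suc k} _ = 0<ι-suc k

      -- Given the colour of `w`, both message systems assign the same probability to the target.
      -- The two marginals are averages of one function of that colour, so they differ by at most
      -- total variation times oscillation.
      entry-step : ∀ {A s s′ f w} → A f ≡ true → A w ≡ false →
        (∀ u z → u ≢ f ⊎ z ≢ w → s u z ≡ s′ u z) → w ≢ v → ∀ {M} → 0# ≤ M →
        (∀ y z → Pr (visit A w) (see s w y) ≤ Pr (visit A w) (see s w z) + M) →
        Pr A s ≤ Pr A s′ + δ (deg w) * M
      entry-step {A} {s} {s′} {f} {w} Af Aw p w≢v {M} 0≤M X-osc =
        0≤y-x⇒x≤y (≤-respʳ regroup (x≤y⇒0≤y-x quotient≤))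
        where
        A⁺ = visit A w
        a  = s f w
        b  = s′ f w

        Za Zb X : Fin q → ℝ
        Za y = Z A⁺ (see s w y)
        Zb y = Z A⁺ (see s′ w y)
        X  y = Pr A⁺ (see s w y)

        α γ Na Nb : ℝ
        α  = sum Za
        γ  = sum Zb
        Na = sum (λ y → Za y * X y)
        Nb = sum (λ y → Zb y * X y)

        0≤Za : ∀ y → 0# ≤ Za y
        0≤Za y = inj₁ (Z-pos A⁺ (see s w y))

        0≤Zb : ∀ y → 0# ≤ Zb y
        0≤Zb y = inj₁ (Z-pos A⁺ (see s′ w y))

        exchange : ∀ y → Za y * φ (Adj? w f) b y ≈ Zb y * φ (Adj? w f) a y
        exchange = T-exchange one {A} {s} {s′} Af Aw p

        target-update : ∀ y π → target (π [ w ≔ y ]) ≈ target π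
        target-update y π = reflexive (≡.cong (λ z → 𝟙 (z Fin.≟ x)) (updateAt-minimal v w π (w≢v ∘ ≡.sym)))

        N-a : ∀ y → N A⁺ (see s w y) ≈ Za y * X y
        N-a y = sym (*-/-cancel _ (Z-pos A⁺ (see s w y)))

        -- At fixed `y` the changed message scales `N` and `Z` by the same ratio, so `X y` is also
        -- the conditional probability under `s′`.
        N-b : ∀ y → N A⁺ (see s′ w y) ≈ Zb y * X y
        N-b y = *-cancelˡ-≈ (φ-pos (Adj? w f) a y) (begin
          φ (Adj? w f) a y * N A⁺ (see s′ w y)  ≈⟨ *-comm _ _ ⟩
          N A⁺ (see s′ w y) * φ (Adj? w f) a y  ≈⟨ T-exchange target {A} {s} {s′} Af Aw p y ⟨
          N A⁺ (see s w y) * φ (Adj? w f) b y   ≈⟨ *-congʳ (N-a y) ⟩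
          Za y * X y * φ (Adj? w f) b y         ≈⟨ solve 3 (λ x y z → x :* y :* z := x :* z :* y) refl _ _ _ ⟩
          Za y * φ (Adj? w f) b y * X y         ≈⟨ *-congʳ (exchange y) ⟩
          Zb y * φ (Adj? w f) a y * X y         ≈⟨ solve 3 (λ x y z → x :* y :* z := y :* (x :* z)) refl _ _ _ ⟩
          φ (Adj? w f) a y * (Zb y * X y)       ∎)

        α≈ : α ≈ ι q * Z A s
        α≈ = T-visit one (λ _ → refl) s Aw

        γ≈ : γ ≈ ι q * Z A s′
        γ≈ = T-visit one (λ _ → refl) s′ Aw

        Na≈ : Na ≈ ι q * N A s
        Na≈ = trans (sum-cong {q} λ y → trans (sym (N-a y)) (∑ᶠ-cong λ π → *-congʳ (sym (target-update y π))))
          (T-visit target target-extensional s Aw)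

        Nb≈ : Nb ≈ ι q * N A s′
        Nb≈ = trans (sum-cong {q} λ y → trans (sym (N-b y)) (∑ᶠ-cong λ π → *-congʳ (sym (target-update y π))))
          (T-visit target target-extensional s′ Aw)

        0<α : 0# < α
        0<α = <.<-respʳ-≈ (sym α≈) (*-pos 0<ιq (Z-pos A s))

        0<γ : 0# < γ
        0<γ = <.<-respʳ-≈ (sym γ≈) (*-pos 0<ιq (Z-pos A s′))

        Pa : α * Pr A s ≈ Na
        Pa = trans (*-congʳ α≈) (trans (*-assoc _ _ _) (trans (*-congˡ (*-/-cancel _ (Z-pos A s))) (sym Na≈)))

        Pb : γ * Pr A s′ ≈ Nb
        Pb = trans (*-congʳ γ≈) (trans (*-assoc _ _ _) (trans (*-congˡ (*-/-cancel _ (Z-pos A s′))) (sym Nb≈)))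

        Δ = δ (deg w)

        lowered : ∀ {z z′ : ℝ} {c d y} → 0# ≤ z → 0# ≤ z′ → z * φ (Adj? w f) c y ≈ z′ * φ (Adj? w f) d y → y ≢ c → z ≤ z′
        lowered {c = c} {d} {y} 0≤z 0≤z′ e y≢c = ≤-resp
          (trans (sym e) (trans (*-congˡ (φ-≢ (Adj? w f) (y≢c ∘ ≡.sym))) (*-identityʳ _))) (*-identityʳ _)
          (*-monoˡ 0≤z′ (φ≤1 (Adj? w f) d y))

        raised : ∀ {z z′ : ℝ} {c d y} → 0# ≤ z → 0# ≤ z′ → z * φ (Adj? w f) c y ≈ z′ * φ (Adj? w f) d y → β * z ≤ z′
        raised {c = c} {d} {y} 0≤z 0≤z′ e = ≤-trans (≤-respˡ (*-comm _ β) (*-monoˡ 0≤z (β≤φ (Adj? w f) c y)))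
          (≤-respˡ (sym e) (≤-respʳ (*-identityʳ _) (*-monoˡ 0≤z′ (φ≤1 (Adj? w f) d y))))

        -- `tilted-≤` goes from the larger total to the smaller. If `s` has the larger one, the
        -- exceptional colour is `b` and the sign is reversed by using `- X`; otherwise the roles
        -- swap and the exceptional colour is `a`.
        difference : Na * γ - Nb * α ≤ Δ * M * (α * γ)
        difference with ≤-total γ α
        ... | inj₁ γ≤α = ≤-respˡ negated
          (tilted-≤ Za Zb (λ y → - X y) b 0≤Za 0<α (inj₁ 0<γ) γ≤α (inj₁ 0<β) (inj₁ β<1) 0≤M
            (λ y y≢b → lowered (0≤Za y) (0≤Zb y) (exchange y) y≢b)
            (raised (0≤Za b) (0≤Zb b) (exchange b))
            (Z-visit-bound A s w b) (δ-bound (deg w))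
            (λ y → ≤-by (X y + M - X b) (x≤y⇒0≤y-x (X-osc b y))
              (solve 3 (λ x b M → :- x :+ (x :+ M :- b) := :- b :+ M) refl (X y) (X b) M)))
          where
          neg : ∀ (Y : Fin q → ℝ) → sum (λ y → Y y * - X y) ≈ - 1# * sum (λ y → Y y * X y)
          neg Y = trans (sum-cong {q} λ y → solve 2 (λ Y X → Y :* (:- X) := (:- 𝟏) :* (Y :* X)) refl (Y y) (X y))
            (sym (*-distribˡ-sum (- 1#) (λ y → Y y * X y)))

          negated : sum (λ y → Zb y * - X y) * α - sum (λ y → Za y * - X y) * γ ≈ Na * γ - Nb * α
          negated = trans (+-cong (*-congʳ (neg Zb)) (-‿cong (*-congʳ (neg Za))))
            (solve 4 (λ a b α γ → ((:- 𝟏) :* b) :* α :- ((:- 𝟏) :* a) :* γ := a :* γ :- b :* α) refl Na Nb α γ)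
        ... | inj₂ α≤γ = ≤-respʳ (*-congˡ (*-comm γ α))
          (tilted-≤ Zb Za X a 0≤Zb 0<γ (inj₁ 0<α) α≤γ (inj₁ 0<β) (inj₁ β<1) 0≤M
            (λ y y≢a → lowered (0≤Zb y) (0≤Za y) (sym (exchange y)) y≢a)
            (raised (0≤Zb a) (0≤Za a) (sym (exchange a)))
            (Z-visit-bound A s′ w a) (δ-bound (deg w))
            (λ y → X-osc y a))

        quotient≤ : Pr A s - Pr A s′ ≤ Δ * M
        quotient≤ = *-cancelˡ-≤ (*-pos 0<α 0<γ) (≤-resp
          (trans (+-cong (*-congʳ (sym Pa)) (-‿cong (*-congʳ (sym Pb))))
            (solve 4 (λ α γ P Q → α :* P :* γ :- γ :* Q :* α := α :* γ :* (P :- Q)) refl α γ _ _))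
          (*-comm _ _) difference)

        regroup : Δ * M - (Pr A s - Pr A s′) ≈ Pr A s′ + Δ * M - Pr A s
        regroup = solve 3 (λ P Q D → D :- (P :- Q) := Q :+ D :- P) refl _ _ _

  -- Sums over self-avoiding walks and their comparison with `ℰ`.

  module WalkSums (G : Graph)
                  (δ : ℕ → ℝ) (0≤δ : ∀ d → 0# ≤ δ d) (v : Vertex G) where
    open Potts ℛ using (ℰ; _^⁺_)
    open Graph G using (Adj; deg; IsSAW; isSAW?; Walk)

    private
      n = order G
      V = Vertex G

    -- At `v` the walk ends with the trivial bound 1 on a difference of probabilities; hence `v`
    -- carries no factor, as in `ℰ`.
    step : V → ℝ → ℝ
    step w b = if does (w Fin.≟ v) then 1# else δ (deg w) * b

    -- p lists the vertices already walked through, most recent first, so that v ∷ p is the walk of ℰ;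
    -- m bounds the number of steps left.
    U : ℕ → ∀ {k} → Vector V (suc k) → ℝ
    U zero    p = 0#
    U (suc m) p = sum λ w → 𝟙 (isSAW? (w ∷ p)) * step w (U m (w ∷ p))

    step-nonneg : ∀ w {b} → 0# ≤ b → 0# ≤ step w b
    step-nonneg w 0≤b with w Fin.≟ v
    ... | yes _ = 0≤1
    ... | no  _ = *-nonneg (0≤δ _) 0≤b

    U-nonneg : ∀ m {k} (p : Vector V (suc k)) → 0# ≤ U m p
    U-nonneg zero    p = ≤-refl
    U-nonneg (suc m) p = sum-nonneg {n} λ w →
      *-nonneg (0≤𝟙 (isSAW? (w ∷ p))) (step-nonneg w (U-nonneg m (w ∷ p)))

    walk : ∀ {ℓ} (p : Vector V (suc ℓ)) → (∀ (i : Fin ℓ) → Adj (p (inject₁ i)) (p (suc i))) →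
           Walk (p zero) (p (fromℕ ℓ)) ℓ
    walk {zero}  p e = Graph.[]
    walk {suc ℓ} p e = e zero Graph.∷ walk (p ∘ suc) (e ∘ suc)

    IsSAW-cong : ∀ {ℓ} {p r : Vector V (suc ℓ)} → p ≗ r → IsSAW p → IsSAW r
    IsSAW-cong p≗r (inj , adj) =
      (λ {i} {j} e → inj (≡.trans (p≗r i) (≡.trans e (≡.sym (p≗r j))))) ,
      (λ i → ≡.subst₂ Adj (p≗r _) (p≗r _) (adj i))

    weight : ∀ {ℓ} → Vector V ℓ → ℝ
    weight p = product λ i → δ (deg (p i))

    weight-nonneg : ∀ {ℓ} (p : Vector V ℓ) → 0# ≤ weight p
    weight-nonneg {ℓ} p = product-nonneg {ℓ} λ i → 0≤δ (deg (p i))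

    ℰ-∑ᶠ : ∀ ℓ → ℰ G δ v ℓ ≈ ∑ᶠ {n} {ℓ} (λ p → 𝟙 (isSAW? (v ∷ p)) * weight p)
    ℰ-∑ᶠ ℓ = trans
      (∑-functions-∑ᶠ (λ p → if does (isSAW? (v ∷ p)) then weight p else 0#) λ {p} {r} e →
        trans (if-𝟙 (isSAW? (v ∷ p)) _) (trans
          (*-cong (𝟙-cong (isSAW? (v ∷ p)) (isSAW? (v ∷ r)) (IsSAW-cong (∷-cong v e)) (IsSAW-cong (∷-cong v (≡.sym ∘ e))))
            (product-cong {ℓ} λ i → reflexive (≡.cong (δ ∘ deg) (e i))))
          (sym (if-𝟙 (isSAW? (v ∷ r)) _))))
      (∑ᶠ-cong λ p → if-𝟙 (isSAW? (v ∷ p)) _)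

    module _ {D : V → Set} (D? : ∀ u → Dec (D u)) where

      ℰᴰ : ℕ → ℝ
      ℰᴰ k = ∑ᶠ {n} {suc k} λ p → 𝟙 (D? (p (fromℕ k))) * (𝟙 (isSAW? (v ∷ p)) * weight p)

      -- Walks with `k` edges begun in `D`, continued by at most `m` further steps. As the newest
      -- vertex comes first, `p (fromℕ k)` is the start. The weight includes the factor of the
      -- start, which `ℰ` has and `U` lacks.
      level : ℕ → ℕ → ℝ
      level k m = ∑ᶠ {n} {suc k} λ p → 𝟙 (D? (p (fromℕ k))) * (𝟙 (isSAW? p) * weight p) * U m p

      U-suc : ∀ m {k} (p : Vector V (suc k)) →
              U (suc m) p ≤ 𝟙 (isSAW? (v ∷ p)) + sum (λ w → 𝟙 (isSAW? (w ∷ p)) * (δ (deg w) * U m (w ∷ p)))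
      U-suc m p = ≤-respʳ
        (trans (∑-distrib-+ (λ w → 𝟙 (w Fin.≟ v) * S w) (λ w → S w * X w)) (+-congʳ (sum-𝟙 v S)))
        (sum-mono {n} pointwise)
        where
        S X : V → ℝ
        S w = 𝟙 (isSAW? (w ∷ p))
        X w = δ (deg w) * U m (w ∷ p)

        pointwise : ∀ w → S w * step w (U m (w ∷ p)) ≤ 𝟙 (w Fin.≟ v) * S w + S w * X w
        pointwise w with w Fin.≟ v
        ... | yes _ = ≤-respˡ (trans (*-identityˡ _) (sym (*-identityʳ _)))
          (x≤x+y (*-nonneg (0≤𝟙 (isSAW? (w ∷ p))) (*-nonneg (0≤δ _) (U-nonneg m (w ∷ p)))))
        ... | no  _ = ≤-reflexive (sym (trans (+-congʳ (zeroˡ _)) (+-identityˡ _)))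

      -- The next step either reaches `v`, completing a walk of `ℰ` with `k + 1` edges, or adds a
      -- vertex.
      level-suc : ∀ k m → level k (suc m) ≤ ℰᴰ k + level (suc k) m
      level-suc k m = ≤-respʳ total (∑ᶠ-mono pointwise)
        where
        B : Vector V (suc k) → ℝ
        B p = 𝟙 (D? (p (fromℕ k))) * weight p

        next : V → Vector V (suc k) → ℝ
        next w p = 𝟙 (D? (p (fromℕ k))) * (𝟙 (isSAW? (w ∷ p)) * weight (w ∷ p)) * U m (w ∷ p)

        pointwise : ∀ p → 𝟙 (D? (p (fromℕ k))) * (𝟙 (isSAW? p) * weight p) * U (suc m) p ≤
                          𝟙 (D? (p (fromℕ k))) * (𝟙 (isSAW? (v ∷ p)) * weight p) + sum (λ w → next w p)
        -- The indicator of `p` itself may be dropped, since every extension brings its own.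
        pointwise p = ≤-trans
          (*-monoʳ (U-nonneg (suc m) p) (*-monoˡ (0≤𝟙 (D? _))
            (≤-respʳ (*-identityˡ _) (*-monoʳ (weight-nonneg p) (𝟙≤1 (isSAW? p))))))
          (≤-respʳ (trans (distribˡ _ _ _) (+-cong
              (solve 3 (λ d w s → d :* w :* s := d :* (s :* w)) refl _ _ _)
              (trans (*-distribˡ-sum (B p) (λ w → 𝟙 (isSAW? (w ∷ p)) * (δ (deg w) * U m (w ∷ p))))
                (sum-cong {n} λ w → solve 5 (λ d w s δ u → d :* w :* (s :* (δ :* u)) := d :* (s :* (δ :* w)) :* u) refl
                  (𝟙 (D? (p (fromℕ k)))) (weight p) (𝟙 (isSAW? (w ∷ p))) (δ (deg w)) (U m (w ∷ p))))))
            (*-monoˡ (*-nonneg (0≤𝟙 (D? _)) (weight-nonneg p)) (U-suc m p)))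

        total : ∑ᶠ (λ p → 𝟙 (D? (p (fromℕ k))) * (𝟙 (isSAW? (v ∷ p)) * weight p) + sum (λ w → next w p)) ≈
                ℰᴰ k + level (suc k) m
        total = trans (∑ᶠ-distrib-+ _ _) (+-congˡ (trans (sym (∑-∑ᶠ-comm next)) (sym (∑ᶠ-∷ _))))

      level-≤ : ∀ {b} → (∀ k → ℰᴰ k ≤ b) → ∀ m k → level k m ≤ ι m * b
      level-≤ {b} h zero    k = ≤-reflexive (trans (∑ᶠ-zero λ p → zeroʳ _) (sym (zeroˡ b)))
      level-≤ {b} h (suc m) k = ≤-respʳ
        (solve 2 (λ m b → b :+ m :* b := (𝟏 :+ m) :* b) refl (ι m) b)
        (≤-trans (level-suc k m) (+-mono-≤ (h k) (level-≤ h m (suc k))))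

      -- The lower bound `c` stands in for the factor of the starting vertex.
      level-zero : ∀ {c} → (∀ d → c ≤ δ d) → ∀ m →
                   c * sum (λ u → 𝟙 (D? u) * U m (u ∷ Vector.[])) ≤ level 0 m
      level-zero {c} c≤δ m = ≤-resp
        (sym (*-distribˡ-sum c (λ u → 𝟙 (D? u) * U m (u ∷ Vector.[])))) (sym (∑ᶠ-∷ _))
        (sum-mono {n} λ u → ≤-respʳ (sym (∑ᶠ-[] _)) (pointwise u))
        where
        pointwise : ∀ u → c * (𝟙 (D? u) * U m (u ∷ Vector.[])) ≤
                    𝟙 (D? u) * (𝟙 (isSAW? (u ∷ Vector.[])) * weight (u ∷ Vector.[])) * U m (u ∷ Vector.[])
        pointwise u = ≤-respʳ
          (trans (solve 3 (λ δ d u → δ :* (d :* u) := d :* (𝟏 :* (δ :* 𝟏)) :* u) refl _ _ _)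
            (*-congʳ (*-congˡ (*-congʳ (sym (𝟙-yes (isSAW? (u ∷ Vector.[])) ((λ { {zero} {zero} _ → ≡.refl }) , λ ())))))))
          (*-monoʳ (*-nonneg (0≤𝟙 (D? u)) (U-nonneg m (u ∷ Vector.[]))) (c≤δ (deg u)))

      ℰᴰ≤ℰ : ∀ k → ℰᴰ k ≤ ℰ G δ v (suc k)
      ℰᴰ≤ℰ k = ≤-respʳ (sym (ℰ-∑ᶠ (suc k))) (∑ᶠ-mono λ p → ≤-respʳ (*-identityˡ _)
        (*-monoʳ (*-nonneg (0≤𝟙 (isSAW? (v ∷ p))) (weight-nonneg p)) (𝟙≤1 (D? _))))

      ℰᴰ-zero : ∀ k → (∀ u → D u → ¬ Walk v u (suc k)) → ℰᴰ k ≈ 0#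
      ℰᴰ-zero k ¬walk = ∑ᶠ-zero λ p → 𝟙-*-zero (D? (p (fromℕ k))) (isSAW? (v ∷ p)) (weight p)
        λ d saw → ¬walk _ d (walk (v ∷ p) (proj₂ saw))

      ^-anti : ∀ {γ} → 0# < γ → γ < 1# → ∀ {j k} → j ℕ.≤ k → γ ^ k ≤ γ ^ j
      ^-anti 0<γ γ<1 {k = zero}  ℕ.z≤n = ≤-refl
      ^-anti 0<γ γ<1 {k = suc k} ℕ.z≤n = ≤-respʳ (*-identityˡ 1#)
        (*-mono-≤ (inj₁ 0<γ) (inj₁ γ<1) (inj₁ (^-pos 0<γ k)) (^-anti 0<γ γ<1 {k = k} ℕ.z≤n))
      ^-anti 0<γ γ<1 (ℕ.s≤s j≤k) = *-monoˡ (inj₁ 0<γ) (^-anti 0<γ γ<1 j≤k)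

      -- No walk shorter than the distance ends in `D`; for longer ones the decay of `ℰ` is at least
      -- as good as at the distance.
      ℰᴰ-≤ : ∀ {γ b} → 0# < γ → γ < 1# → 0# ≤ b → (∀ ℓ → 1 ℕ.≤ ℓ → ℰ G δ v ℓ < b * γ ^ ℓ) →
             ∀ d → IsDistance G v D d → ∀ k → ℰᴰ k ≤ b * γ ^⁺ d
      ℰᴰ-≤ {γ} {b} 0<γ γ<1 0≤b h ⊤⁺ dist k =
        ≤-reflexive (trans (ℰᴰ-zero k λ u d → dist u (suc k) d) (sym (zeroʳ b)))
      ℰᴰ-≤ {γ} {b} 0<γ γ<1 0≤b h [ d ] (_ , least) k with d ℕ.≤? suc k
      ... | yes d≤ = ≤-trans (ℰᴰ≤ℰ k) (≤-trans (inj₁ (h (suc k) (ℕ.s≤s ℕ.z≤n))) (*-monoˡ 0≤b (^-anti 0<γ γ<1 d≤)))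
      ... | no  d≰ = ≤-respˡ (sym (ℰᴰ-zero k λ u Du w → d≰ (least u (suc k) Du w)))
        (*-nonneg 0≤b (inj₁ (^-pos 0<γ d)))

      ∑-U-≤ : ∀ {γ b c} → 0# < γ → γ < 1# → 0# ≤ b → (∀ ℓ → 1 ℕ.≤ ℓ → ℰ G δ v ℓ < b * γ ^ ℓ) →
              (∀ d → c ≤ δ d) → ∀ d → IsDistance G v D d → ∀ m →
              c * sum (λ u → 𝟙 (D? u) * U m (u ∷ Vector.[])) ≤ ι m * (b * γ ^⁺ d)
      ∑-U-≤ 0<γ γ<1 0≤b h c≤δ d dist m =
        ≤-trans (level-zero c≤δ m) (level-≤ (ℰᴰ-≤ 0<γ γ<1 0≤b h d dist) m 0)

  -- Changing one coordinate at a time.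

  module Interpolation where

    -- A telescoping sum. The one-coordinate bound is required at all `z`, `z′` because the
    -- intermediate points mix entries of `x` and `x′`. It serves for the messages of one vertex and
    -- again for the vertices of the boundary.
    interpolate : ∀ {a} {X : Set a} {k} (g : (Fin k → X) → ℝ) (B : Vector ℝ k) (x x′ : Fin k → X) →
      (∀ {z z′} → z ≗ z′ → g z ≈ g z′) →
      (∀ j z z′ → (∀ i → i ≢ j → z i ≡ z′ i) → z j ≡ x j → z′ j ≡ x′ j → g z ≤ g z′ + B j) →
      g x ≤ g x′ + sum B
    interpolate {k = zero}  g B x x′ ext h = ≤-reflexive (trans (ext λ ()) (sym (+-identityʳ _)))
    interpolate {X = X} {suc k} g B x x′ ext h = ≤-trans
      (h zero x (x′ zero ∷ tail x) (λ { zero 0≢0 → contradiction ≡.refl 0≢0 ; (suc i) _ → ≡.refl }) ≡.refl ≡.refl)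
      (≤-respʳ (trans (+-congʳ (+-congʳ (ext (λ { zero → ≡.refl ; (suc i) → ≡.refl }))))
          (solve 3 (λ g s b → (g :+ s) :+ b := g :+ (b :+ s)) refl (g x′) (sum (B ∘ suc)) (B zero)))
        (+-mono-≤ rest ≤-refl))
      where
      open Vector using (tail)

      rest : g (x′ zero ∷ tail x) ≤ g (x′ zero ∷ tail x′) + sum (B ∘ suc)
      rest = interpolate (λ z → g (x′ zero ∷ z)) (B ∘ suc) (tail x) (tail x′)
        (λ e → ext λ { zero → ≡.refl ; (suc i) → e i })
        (λ j z z′ e p p′ → h (suc j) (x′ zero ∷ z) (x′ zero ∷ z′)
          (λ { zero _ → ≡.refl ; (suc i) i≢j → e i (i≢j ∘ ≡.cong suc) }) p p′)

  -- Influence of the boundary along walks.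

  module Decay (q : ℕ) (y₀ : Fin q) (G : Graph)
               (β : ℝ) (0<β : 0# < β) (β<1 : β < 1#)
               (δ : ℕ → ℝ) (0≤δ : ∀ d → 0# ≤ δ d)
               (δ-bound : ∀ d κ → 0# ≤ κ → κ ≤ 1# → κ * ι q ≤ (1# - β) + κ * (ι d * (1# - β)) → κ ≤ δ d)
               (v : Vertex G) (x : Fin q) where
    open Interpolation
    open Messages q G β 0<β β<1
    open Marginals q y₀ G β 0<β β<1 v x
    open Contraction δ δ-bound
    open WalkSums G δ 0≤δ v
    open Graph G using (Adj; Adj?; Adj-irrefl; IsSAW; isSAW?)

    private
      n = order G
      V = Vertex G

    Pr-s-cong : ∀ {A s s′} → (∀ u w → A u ≡ true → Adj u w → s u w ≡ s′ u w) → Pr A s ≈ Pr A s′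
    Pr-s-cong {A} {s} {s′} p = Pr-cong {A} {s} {A} {s′} (T-cong one A p) (T-cong target A p)

    row-≗ : ∀ {f} (s : Message) {r r′} → r ≗ r′ → ∀ u w → (s [ f ≔ r ]) u w ≡ (s [ f ≔ r′ ]) u w
    row-≗ {f} s {r} {r′} e u w with u Fin.≟ f
    ... | yes ≡.refl rewrite updateAt-updates f {const r} s | updateAt-updates f {const r′} s = e w
    ... | no  u≢f rewrite updateAt-minimal u f {const r} s u≢f | updateAt-minimal u f {const r′} s u≢f = ≡.refl

    row-at : ∀ f (s : Message) r w → (s [ f ≔ r ]) f w ≡ r w
    row-at f s r w rewrite updateAt-updates f {const r} s = ≡.refl

    row-off : ∀ f (s : Message) r {u} → u ≢ f → ∀ w → (s [ f ≔ r ]) u w ≡ s u w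
    row-off f s r {u} u≢f w rewrite updateAt-minimal u f {const r} s u≢f = ≡.refl

    RowOnly : V → Message → Message → Set
    RowOnly f s s′ = ∀ u → u ≢ f → ∀ w → s u w ≡ s′ u w

    see-RowOnly : ∀ s w y z → RowOnly w (see s w y) (see s w z)
    see-RowOnly s w y z u u≢w t =
      ≡.trans (row-off w s (const y) u≢w t) (≡.sym (row-off w s (const z) u≢w t))

    extend : ∀ {k} {p : Vector V (suc k)} {A : V → Bool} {w} → IsSAW p → (∀ i → A (p i) ≡ true) →
             A w ≡ false → Adj w (p zero) → IsSAW (w ∷ p)
    extend {k} {p} {A} {w} (inj , adj) Ap Aw e = (λ {i} {j} → injective i j) , adjacent
      where
      fresh : ∀ i → w ≢ p i
      fresh i ≡.refl with () ← ≡.trans (≡.sym (Ap i)) Aw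

      injective : ∀ i j → (w ∷ p) i ≡ (w ∷ p) j → i ≡ j
      injective zero    zero    _ = ≡.refl
      injective zero    (suc j) r = contradiction r (fresh j)
      injective (suc i) zero    r = contradiction (≡.sym r) (fresh i)
      injective (suc i) (suc j) r = ≡.cong suc (inj r)

      adjacent : ∀ (i : Fin (suc k)) → Adj ((w ∷ p) (inject₁ i)) ((w ∷ p) (suc i))
      adjacent zero    = e
      adjacent (suc i) = adj i

    visited-∷ : ∀ {k} {p : Vector V (suc k)} {A : V → Bool} w → (∀ i → A (p i) ≡ true) →
                ∀ i → visit A w ((w ∷ p) i) ≡ true
    visited-∷ {A = A} w Ap zero = updateAt-updates w A
    visited-∷ {p = p} {A = A} w Ap (suc i) with p i Fin.≟ w
    ... | yes pi≡w rewrite pi≡w = updateAt-updates w A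
    ... | no  pi≢w = ≡.trans (updateAt-minimal (p i) w A pi≢w) (Ap i)

    -- The messages of `p zero` are changed one by one, each change passing to the colour of its
    -- receiver, where the induction hypothesis bounds the oscillation. The equation `m + k ≡ n`
    -- ensures that the steps do not run out before the vertices do.
    row-influence : ∀ m {k} (p : Vector V (suc k)) → m ℕ.+ k ≡ n → IsSAW p →
      ∀ {A s s′} → (∀ i → A (p i) ≡ true) → A v ≡ false → RowOnly (p zero) s s′ →
      Pr A s ≤ Pr A s′ + U m p
    -- Here `p` would list `n + 1` distinct vertices.
    row-influence zero {k} p ≡.refl (inj , _) _ _ _ =
      contradiction (Fin.injective⇒≤ {f = p} inj) (ℕ.<⇒≱ (ℕ.n<1+n k))
    row-influence (suc m) {k} p m+k saw {A} {s} {s′} Ap Av only = ≤-resp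
      (Pr-s-cong {A} λ u w _ _ → own s u w (λ _ → ≡.refl))
      (+-congʳ (Pr-s-cong {A} λ u w _ _ → own s′ u w λ u≢f → only u u≢f w))
      (interpolate (λ r → Pr A (s [ f ≔ r ])) _ (s f) (s′ f)
        (λ e → Pr-s-cong {A} λ u w _ _ → row-≗ s e u w) entry)
      where
      f = p zero

      own : ∀ s′ u w → (u ≢ f → s u w ≡ s′ u w) → (s [ f ≔ s′ f ]) u w ≡ s′ u w
      own s′ u w e with u Fin.≟ f
      ... | yes ≡.refl = row-at f s (s′ f) w
      ... | no  u≢f    = ≡.trans (row-off f s (s′ f) u≢f w) (e u≢f)

      b : V → ℝ
      b w = 𝟙 (isSAW? (w ∷ p)) * step w (U m (w ∷ p))

      0≤b : ∀ w → 0# ≤ b w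
      0≤b w = *-nonneg (0≤𝟙 (isSAW? (w ∷ p))) (step-nonneg w (U-nonneg m (w ∷ p)))

      entry : ∀ w r r′ → (∀ u → u ≢ w → r u ≡ r′ u) → r w ≡ s f w → r′ w ≡ s′ f w →
              Pr A (s [ f ≔ r ]) ≤ Pr A (s [ f ≔ r′ ]) + b w
      entry w r r′ r≗r′ _ _ = cases (Adj? w f) (A w) ≡.refl
        where
        agree : ∀ u z → u ≢ f ⊎ z ≢ w → (s [ f ≔ r ]) u z ≡ (s [ f ≔ r′ ]) u z
        agree u z d with u Fin.≟ f
        agree u z (inj₁ u≢f) | yes u≡f = contradiction u≡f u≢f
        agree u z (inj₂ z≢w) | yes ≡.refl = ≡.trans (row-at f s r z) (≡.trans (r≗r′ z z≢w) (≡.sym (row-at f s r′ z)))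
        agree u z _ | no u≢f = ≡.trans (row-off f s r u≢f z) (≡.sym (row-off f s r′ u≢f z))

        fresh : (saw′ : IsSAW (w ∷ p)) → A w ≡ false →
                Pr A (s [ f ≔ r ]) ≤ Pr A (s [ f ≔ r′ ]) + step w (U m (w ∷ p))
        fresh saw′ Aw with w Fin.≟ v
        ... | yes _   = ≤-trans (Pr≤1 A _) (≤-respʳ (+-comm _ _) (x≤x+y (Pr-nonneg A _)))
        ... | no  w≢v = entry-step {A} (Ap zero) Aw agree w≢v (U-nonneg m (w ∷ p)) λ y z →
          row-influence m (w ∷ p) (≡.trans (ℕ.+-suc m k) m+k) saw′ {visit A w}
            (visited-∷ {p = p} {A} w Ap) (≡.trans (updateAt-minimal v w A (w≢v ∘ ≡.sym)) Av)
            (see-RowOnly (s [ f ≔ r ]) w y z)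

        -- A message along a non-edge is never read and one to a frozen vertex cancels; only a fresh
        -- neighbour prolongs the walk.
        cases : Dec (Adj w f) → ∀ c → A w ≡ c → Pr A (s [ f ≔ r ]) ≤ Pr A (s [ f ≔ r′ ]) + b w
        cases (no ¬e) _ _ = ≤-respˡ
          (sym (Pr-s-cong {A} λ u z _ e → agree u z (different u z e))) (x≤x+y (0≤b w))
          where
          different : ∀ u z → Adj u z → u ≢ f ⊎ z ≢ w
          different u z e with u Fin.≟ f
          ... | no  u≢f    = inj₁ u≢f
          ... | yes ≡.refl = inj₂ λ { ≡.refl → ¬e (Graph.Adj-sym G e) }
        cases (yes e) true Aw = ≤-respˡ
          (sym (Pr-visited {A} (Ap zero) Aw (λ f≡w → Adj-irrefl (≡.sym f≡w) e) agree)) (x≤x+y (0≤b w))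
        cases (yes e) false Aw = ≤-respʳ
          (+-congˡ (sym (trans (*-congʳ (𝟙-yes (isSAW? (w ∷ p)) saw′)) (*-identityˡ _)))) (fresh saw′ Aw)
          where saw′ = extend saw Ap Aw e

    boundary-influence : ∀ {D : V → Set} (D? : ∀ u → Dec (D u)) {A s s′} → A v ≡ false →
      (∀ u → D u → A u ≡ true) → (∀ u → ¬ D u → s u ≡ s′ u) →
      Pr A s ≤ Pr A s′ + sum (λ u → 𝟙 (D? u) * U n (u ∷ Vector.[]))
    boundary-influence {D} D? {A} {s} {s′} Av AD same = interpolate (Pr A) _ s s′
      (λ e → Pr-s-cong {A} λ u w _ _ → ≡.cong-app (e u) w) row
      where
      row : ∀ u z z′ → (∀ w → w ≢ u → z w ≡ z′ w) → z u ≡ s u → z′ u ≡ s′ u →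
            Pr A z ≤ Pr A z′ + 𝟙 (D? u) * U n (u ∷ Vector.[])
      row u z z′ off at at′ with D? u
      ... | yes Du = ≤-respʳ (+-congˡ (sym (*-identityˡ _)))
        (row-influence n (u ∷ Vector.[]) (ℕ.+-identityʳ n) ((λ { {zero} {zero} _ → ≡.refl }) , λ ())
          {A} (λ { zero → AD u Du }) Av (λ w w≢u t → ≡.cong-app (off w w≢u) t))
      ... | no ¬Du = ≤-reflexive (trans (Pr-s-cong {A} λ w t _ _ → ≡.cong-app (eq w) t)
          (sym (trans (+-congˡ (zeroˡ _)) (+-identityʳ _))))
        where
        eq : ∀ w → z w ≡ z′ w
        eq w with w Fin.≟ u
        ... | no  w≢u    = off w w≢u
        ... | yes ≡.refl = ≡.trans at (≡.trans (same u ¬Du) (≡.sym at′))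

  -- From Potts instances to frozen messages.

  module Pinning where
    open SetoidReasoning setoid

    product-zero : ∀ {n} (f : Vector ℝ n) i → f i ≈ 0# → product f ≈ 0#
    product-zero f zero    p = trans (*-congʳ p) (zeroˡ _)
    product-zero f (suc i) p = trans (*-congˡ (product-zero (f ∘ suc) i p)) (zeroʳ _)

    𝟙-∀ : ∀ {n a b} {A : Set a} {P : Fin n → Set b} (A? : Dec A) (P? : ∀ i → Dec (P i)) →
          (A → ∀ i → P i) → ((∀ i → P i) → A) → 𝟙 A? ≈ product (λ i → 𝟙 (P? i))
    𝟙-∀ {n} A? P? f g with Fin.all? P?
    ... | yes ∀P = trans (𝟙-yes A? (g ∀P)) (sym (product-one {n} λ i → 𝟙-yes (P? i) (∀P i)))
    ... | no ¬∀P with i , ¬Pi , _ ← Fin.¬∀⟶∃¬-smallest n _ P? ¬∀P =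
      trans (𝟙-no A? (¬∀P ∘ f)) (sym (product-zero (λ i → 𝟙 (P? i)) i (𝟙-no (P? i) ¬Pi)))

    module _ {q : ℕ} where

      multiplicity : ∀ {n} {M : Fin n → Set} → (∀ u → Dec (M u)) → ℝ
      multiplicity M? = product λ u → if does (M? u) then ι q else 1#

      pinned : ∀ {n} {M : Fin n → Set} → (∀ u → Dec (M u)) → (Fin n → Fin q) → (Fin n → Fin q) → ℝ
      pinned M? σ π = product λ u → 𝟙 (M? u →-dec (π u Fin.≟ σ u))

      -- An instance fixes the colours in `M`, whereas the message model sums over them unread. The
      -- two sums differ by the factor `q` for each such vertex.
      ∑ᶠ-pinned : ∀ {n} {M : Fin n → Set} (M? : ∀ u → Dec (M u)) (σ : Fin n → Fin q) (F : (Fin n → Fin q) → ℝ) →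
        (∀ {π ρ} → (∀ u → ¬ M u → π u ≡ ρ u) → F π ≈ F ρ) →
        ∑ᶠ F ≈ multiplicity M? * ∑ᶠ (λ π → pinned M? σ π * F π)
      ∑ᶠ-pinned {zero} M? σ F _ = trans (∑ᶠ-[] F)
        (sym (trans (*-identityˡ _) (trans (∑ᶠ-[] _) (*-identityˡ _))))
      ∑ᶠ-pinned {suc n} {M} M? σ F indep = trans (∑ᶠ-∷ F) (trans (body (M? zero)) (*-congˡ (sym (∑ᶠ-∷ _))))
        where
        M?′ = M? ∘ suc
        K   = multiplicity M?′
        p   = pinned M?′ (σ ∘ suc)

        S : Fin q → ℝ
        S y = ∑ᶠ λ π → p π * F (y ∷ π)

        ih : ∀ y → ∑ᶠ (λ π → F (y ∷ π)) ≈ K * S y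
        ih y = ∑ᶠ-pinned M?′ (σ ∘ suc) (λ π → F (y ∷ π))
          λ e → indep λ { zero _ → ≡.refl ; (suc u) ¬M → e u ¬M }

        body : (M₀? : Dec (M zero)) →
          sum (λ y → ∑ᶠ (λ π → F (y ∷ π))) ≈
          (if does M₀? then ι q else 1#) * K * sum (λ y → ∑ᶠ (λ π → 𝟙 (M₀? →-dec (y Fin.≟ σ zero)) * p π * F (y ∷ π)))
        body (no _) = begin
          sum (λ y → ∑ᶠ (λ π → F (y ∷ π)))
            ≈⟨ sum-cong {q} ih ⟩
          sum (λ y → K * S y)
            ≈⟨ *-distribˡ-sum K S ⟨
          K * sum S
            ≈⟨ *-cong (sym (*-identityˡ K)) (sum-cong {q} λ y → ∑ᶠ-cong λ π → *-congʳ (sym (*-identityˡ _))) ⟩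
          1# * K * sum (λ y → ∑ᶠ (λ π → 1# * p π * F (y ∷ π))) ∎
        body (yes m) = begin
          sum (λ y → ∑ᶠ (λ π → F (y ∷ π)))
            ≈⟨ sum-cong {q} (λ y → trans (∑ᶠ-cong λ π → indep λ { zero ¬m → contradiction m ¬m ; (suc u) _ → ≡.refl }) (ih (σ zero))) ⟩
          sum {q} (λ y → K * S (σ zero))
            ≈⟨ sum-const q _ ⟩
          ι q * (K * S (σ zero))
            ≈⟨ *-assoc _ _ _ ⟨
          ι q * K * S (σ zero)
            ≈⟨ *-congˡ (sum-𝟙 (σ zero) S) ⟨
          ι q * K * sum (λ y → 𝟙 (y Fin.≟ σ zero) * S y)
            ≈⟨ *-congˡ (sum-cong {q} λ y → trans (*-distribˡ-∑ᶠ _ _) (∑ᶠ-cong λ π → sym (*-assoc _ _ _))) ⟩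
          ι q * K * sum (λ y → ∑ᶠ (λ π → 𝟙 (y Fin.≟ σ zero) * p π * F (y ∷ π))) ∎

  module ListProducts where

    listProduct : ∀ {a} {A : Set a} → (A → ℝ) → List A → ℝ
    listProduct f = foldr (λ e r → f e * r) 1#

    listProduct-++ : ∀ {a} {A : Set a} (f : A → ℝ) xs ys → listProduct f (xs List.++ ys) ≈ listProduct f xs * listProduct f ys
    listProduct-++ f []       ys = sym (*-identityˡ _)
    listProduct-++ f (x ∷ₗ xs) ys = trans (*-congˡ (listProduct-++ f xs ys)) (sym (*-assoc _ _ _))

    listProduct-map-tabulate : ∀ {a b c} {A : Set a} {B : Set b} {C : Set c} (f : C → ℝ) (g : B → C) {n} (h : Fin n → B) →
      listProduct f (List.map g (tabulate h)) ≈ product (λ i → f (g (h i)))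
    listProduct-map-tabulate f g {zero}  h = refl
    listProduct-map-tabulate {A = A} f g {suc n} h = *-congˡ (listProduct-map-tabulate {A = A} f g (h ∘ suc))

    listProduct-cartesianProduct : ∀ {a b} {A : Set a} {B : Set b} (f : A × B → ℝ) {m n} (g : Fin m → A) (h : Fin n → B) →
      listProduct f (cartesianProduct (tabulate g) (tabulate h)) ≈ product (λ i → product (λ j → f (g i , h j)))
    listProduct-cartesianProduct f {zero}  g h = refl
    listProduct-cartesianProduct {A = A} f {suc m} g h = trans (listProduct-++ f (List.map (g zero ,_) (tabulate h)) _)
      (*-cong (listProduct-map-tabulate {A = A} f (g zero ,_) h) (listProduct-cartesianProduct f (g ∘ suc) h))

    ^-length-filter : ∀ {a p r} {A : Set a} {P : Pred A p} {Q : Pred A r} (P? : Decidable P) (Q? : Decidable Q) β xs →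
      β ^ List.length (filter Q? (filter P? xs)) ≈
      listProduct (λ e → if does (P? e) then (if does (Q? e) then β else 1#) else 1#) xs
    ^-length-filter P? Q? β [] = refl
    ^-length-filter P? Q? β (x ∷ₗ xs) with P? x
    ... | no  _ = trans (^-length-filter P? Q? β xs) (sym (*-identityˡ _))
    ... | yes _ with Q? x
    ...   | yes _ = *-congˡ (^-length-filter P? Q? β xs)
    ...   | no  _ = trans (^-length-filter P? Q? β xs) (sym (*-identityˡ _))

  module PottsSums {q : ℕ} (β : ℝ) (0≤β : 0# ≤ β)
                   (Ω : Instance q) (v : Vertex (Instance.G Ω)) (x : Fin q) where
    open Instance Ω
    open Potts ℛ using (Feasible; marginal; module Gibbs)
    open Gibbs β Ω using (monochromatic; weight) renaming (Z to Zᵍ)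
    open SetoidReasoning setoid

    private
      n = order G
      V = Vertex G

    Zₚ Nₚ : ℝ
    Zₚ = ∑ᶠ weight
    Nₚ = ∑ᶠ λ π → 𝟙 (π v Fin.≟ x) * weight π

    Agrees-cong : ∀ {π ρ} → π ≗ ρ → Agrees π → Agrees ρ
    Agrees-cong e h u u∈Λ = ≡.trans (≡.sym (e u)) (h u u∈Λ)

    monochromatic-cong : ∀ {π ρ : V → Fin q} → π ≗ ρ → monochromatic π ≡ monochromatic ρ
    monochromatic-cong {π} {ρ} e = ≡.cong List.length (filter-≐ (λ e → π (proj₁ e) Fin.≟ π (proj₂ e)) (λ e → ρ (proj₁ e) Fin.≟ ρ (proj₂ e))
      ( (λ {(u , w)} p → ≡.trans (≡.sym (e u)) (≡.trans p (e w)))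
      , (λ {(u , w)} p → ≡.trans (e u) (≡.trans p (≡.sym (e w))))) (Graph.edges G))

    weight-𝟙 : ∀ π → weight π ≈ 𝟙 (agrees? π) * β ^ monochromatic π
    weight-𝟙 π = if-𝟙 (agrees? π) _

    weight-extensional : Extensional weight
    weight-extensional {π} {ρ} e = trans (weight-𝟙 π) (trans
      (*-cong (𝟙-cong (agrees? π) (agrees? ρ) (Agrees-cong e) (Agrees-cong (≡.sym ∘ e)))
        (reflexive (≡.cong (β ^_) (monochromatic-cong e))))
      (sym (weight-𝟙 ρ)))

    ^-nonneg : ∀ k → 0# ≤ β ^ k
    ^-nonneg zero    = 0≤1
    ^-nonneg (suc k) = *-nonneg 0≤β (^-nonneg k)

    weight-nonneg : ∀ π → 0# ≤ weight π
    weight-nonneg π = ≤-respʳ (sym (weight-𝟙 π)) (*-nonneg (0≤𝟙 (agrees? π)) (^-nonneg (monochromatic π)))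

    Nₚ-nonneg : 0# ≤ Nₚ
    Nₚ-nonneg = ∑ᶠ-nonneg λ π → *-nonneg (0≤𝟙 (π v Fin.≟ x)) (weight-nonneg π)

    Nₚ≤Zₚ : Nₚ ≤ Zₚ
    Nₚ≤Zₚ = ∑ᶠ-mono λ π → ≤-respʳ (*-identityˡ _) (*-monoʳ (weight-nonneg π) (𝟙≤1 (π v Fin.≟ x)))

    Zₚ-pos : Feasible β Ω → 0# < Zₚ
    Zₚ-pos (π , 0<w) = <-≤-trans 0<w (term≤∑ᶠ weight-extensional weight-nonneg π)

    Zₚ*marginal : 0# < Zₚ → Zₚ * marginal β Ω v x ≈ Nₚ
    Zₚ*marginal 0<Z = begin
      Zₚ * marginal β Ω v x
        ≈⟨ *-congˡ (∑-functions-∑ᶠ _ λ {π} {ρ} e → trans (split π) (trans (*-cong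
             (reflexive (≡.cong (λ y → 𝟙 (y Fin.≟ x)) (e v))) (*-congʳ (weight-extensional e))) (sym (split ρ)))) ⟩
      Zₚ * ∑ᶠ (λ π → if does (π v Fin.≟ x) then weight π / Zᵍ else 0#)
        ≈⟨ *-distribˡ-∑ᶠ Zₚ _ ⟩
      ∑ᶠ (λ π → Zₚ * (if does (π v Fin.≟ x) then weight π / Zᵍ else 0#))
        ≈⟨ ∑ᶠ-cong (λ π → trans (*-congˡ (split π)) (trans
             (solve 4 (λ Z i w r → Z :* (i :* (w :* r)) := i :* (w :* (Z :* r))) refl _ _ _ _)
             (*-congˡ (trans (*-congˡ ZZ⁻¹) (*-identityʳ _))))) ⟩
      Nₚ ∎
      where
      split : ∀ π → (if does (π v Fin.≟ x) then weight π / Zᵍ else 0#) ≈ 𝟙 (π v Fin.≟ x) * (weight π / Zᵍ)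
      split π = if-𝟙 (π v Fin.≟ x) _

      Zᵍ≈Zₚ : Zᵍ ≈ Zₚ
      Zᵍ≈Zₚ = ∑-functions-∑ᶠ weight weight-extensional

      ZZ⁻¹ : Zₚ * Zᵍ ⁻¹ ≈ 1#
      ZZ⁻¹ = trans (*-congʳ (sym Zᵍ≈Zₚ)) (⁻¹-inverseʳ Zᵍ (pos⇒≉0 (<.<-respʳ-≈ (sym Zᵍ≈Zₚ) 0<Z)))

    marginal-pinned : 0# < Zₚ → (v∈Λ : v ∈ Λ) → marginal β Ω v x ≈ 𝟙 (σ v v∈Λ Fin.≟ x)
    marginal-pinned 0<Z v∈Λ = *-cancelˡ-≈ 0<Z (trans (Zₚ*marginal 0<Z) (sym (trans (*-comm _ _)
      (trans (*-distribˡ-∑ᶠ _ weight) (∑ᶠ-cong pointwise)))))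
      where
      pointwise : ∀ π → 𝟙 (σ v v∈Λ Fin.≟ x) * weight π ≈ 𝟙 (π v Fin.≟ x) * weight π
      pointwise π = trans (extract _ π) (trans
        (𝟙-*-cong (agrees? π) λ h → *-congʳ (reflexive (≡.cong (λ y → 𝟙 (y Fin.≟ x)) (≡.sym (h v v∈Λ)))))
        (sym (extract _ π)))
        where
        extract : ∀ c π → c * weight π ≈ 𝟙 (agrees? π) * (c * β ^ monochromatic π)
        extract c π = trans (*-congˡ (weight-𝟙 π)) (solve 3 (λ c i w → c :* (i :* w) := i :* (c :* w)) refl _ _ _)

    marginal-nonneg : 0# < Zₚ → 0# ≤ marginal β Ω v x
    marginal-nonneg 0<Z = *-cancelˡ-≤ 0<Z (≤-resp (sym (zeroʳ _)) (sym (Zₚ*marginal 0<Z)) Nₚ-nonneg)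

    marginal≤1 : 0# < Zₚ → marginal β Ω v x ≤ 1#
    marginal≤1 0<Z = *-cancelˡ-≤ 0<Z (≤-resp (sym (Zₚ*marginal 0<Z)) (sym (*-identityʳ _)) Nₚ≤Zₚ)

  module FreeVertex {q : ℕ} (y₀ : Fin q)
                    (β : ℝ) (0<β : 0# < β) (β<1 : β < 1#)
                    (Ω : Instance q) (v : Vertex (Instance.G Ω)) (x : Fin q) where
    open Pinning
    open ListProducts
    open Instance Ω
    open Potts ℛ using (module Gibbs)
    open Gibbs β Ω using (monochromatic; weight)
    open PottsSums β (inj₁ 0<β) Ω v x
    open Messages q G β 0<β β<1
    open Marginals q y₀ G β 0<β β<1 v x
    open SetoidReasoning setoid

    private
      V = Vertex G

    -- Outside Λ the value y₀ is never read.
    extension : V → Fin q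
    extension u with u ∈? Λ
    ... | yes u∈Λ = σ u u∈Λ
    ... | no  _   = y₀

    extension-∈ : ∀ {u} (u∈Λ : u ∈ Λ) → extension u ≡ σ u u∈Λ
    extension-∈ {u} u∈Λ with u ∈? Λ
    ... | yes _   = ≡.refl
    ... | no  u∉Λ = contradiction u∈Λ u∉Λ

    pinnedVertices : V → Bool
    pinnedVertices u = does (u ∈? Λ)

    boundary : Message
    boundary u _ = extension u

    opaque
      unfolding φ

      ^-monochromatic : ∀ π → β ^ monochromatic π ≈ W (λ u _ → π u)
      ^-monochromatic π = trans (^-length-filter (λ e → pair? (proj₁ e) (proj₂ e)) (λ e → π (proj₁ e) Fin.≟ π (proj₂ e)) β
          (cartesianProduct (List.allFin (order G)) (List.allFin (order G))))
        (listProduct-cartesianProduct (λ e → φ (pair? (proj₁ e) (proj₂ e)) (π (proj₁ e)) (π (proj₂ e))) (λ u → u) (λ u → u))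

    weight-W : ∀ π → weight π ≈ pinned (_∈? Λ) extension π * W (msg pinnedVertices boundary π)
    weight-W π = trans (if-𝟙 (agrees? π) _) (trans onAgreement (*-congʳ (𝟙-∀ (agrees? π) (λ u → (u ∈? Λ) →-dec (π u Fin.≟ extension u))
        (λ h u u∈Λ → ≡.trans (h u u∈Λ) (≡.sym (extension-∈ u∈Λ)))
        (λ h u u∈Λ → ≡.trans (h u u∈Λ) (extension-∈ u∈Λ)))))
      where
      onAgreement : 𝟙 (agrees? π) * β ^ monochromatic π ≈ 𝟙 (agrees? π) * W (msg pinnedVertices boundary π)
      onAgreement = 𝟙-*-cong (agrees? π) λ h → trans (^-monochromatic π) (W-cong λ u w _ → same h u)
        where
        same : Agrees π → ∀ u → π u ≡ (if does (u ∈? Λ) then extension u else π u)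
        same h u with u ∈? Λ | extension-∈ {u}
        ... | yes u∈Λ | e = ≡.trans (h u u∈Λ) (≡.sym (e u∈Λ))
        ... | no  _   | _ = ≡.refl

    K : ℝ
    K = multiplicity {q} (_∈? Λ)

    K-pos : 0# < K
    K-pos = product-pos positive
      where
      0<ι : ∀ {k} → Fin k → 0# < ι k
      0<ι {suc k} _ = 0<ι-suc k

      positive : ∀ u → 0# < (if does (u ∈? Λ) then ι q else 1#)
      positive u with u ∈? Λ
      ... | yes _ = 0<ι y₀
      ... | no  _ = 0<1

    T-weight : ∀ (ψ : (V → Fin q) → ℝ) → (∀ {π ρ} → (∀ u → ¬ (u ∈ Λ) → π u ≡ ρ u) → ψ π ≈ ψ ρ) →
               T ψ pinnedVertices boundary ≈ K * ∑ᶠ (λ π → ψ π * weight π)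
    T-weight ψ indep = trans
      (∑ᶠ-pinned (_∈? Λ) extension (λ π → ψ π * W (msg pinnedVertices boundary π))
        λ {π} {ρ} e → *-cong (indep e) (W-cong λ u w _ → same {π} {ρ} e u))
      (*-congˡ (∑ᶠ-cong λ π → trans (solve 3 (λ a b c → a :* (b :* c) := b :* (a :* c)) refl _ _ _) (*-congˡ (sym (weight-W π)))))
      where
      same : ∀ {π ρ} → (∀ u → ¬ (u ∈ Λ) → π u ≡ ρ u) → ∀ u →
             (if does (u ∈? Λ) then extension u else π u) ≡ (if does (u ∈? Λ) then extension u else ρ u)
      same {π} {ρ} e u with u ∈? Λ
      ... | yes _   = ≡.refl
      ... | no  u∉Λ = e u u∉Λ

    Z-Zₚ : Z pinnedVertices boundary ≈ K * Zₚ
    Z-Zₚ = trans (T-weight one λ _ → refl) (*-congˡ (∑ᶠ-cong λ π → *-identityˡ _))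

    -- At positive activity every boundary condition is feasible.
    Zₚ-positive : 0# < Zₚ
    Zₚ-positive = *-cancelˡ-< (<.<-respʳ-≈ Z-Zₚ (Z-pos pinnedVertices boundary))
      where
      *-cancelˡ-< : 0# < K * Zₚ → 0# < Zₚ
      *-cancelˡ-< p with ≤-total Zₚ 0#
      ... | inj₁ Z≤0 = contradiction p (≤⇒≯ (≤-respʳ (zeroʳ K) (*-monoˡ (inj₁ K-pos) Z≤0)))
      ... | inj₂ (inj₁ 0<Z) = 0<Z
      ... | inj₂ (inj₂ 0≈Z) = contradiction p (≤⇒≯ (inj₂ (trans (*-congˡ (sym 0≈Z)) (zeroʳ K))))

    -- The message model still sums over the colours in `Λ`, so at a pinned `v` the target would
    -- read a colour unrelated to `σ`.
    Zₚ*Pr : ¬ (v ∈ Λ) → Zₚ * Pr pinnedVertices boundary ≈ Nₚ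
    Zₚ*Pr v∉Λ = *-cancelˡ-≈ K-pos (begin
      K * (Zₚ * Pr pinnedVertices boundary)   ≈⟨ *-assoc _ _ _ ⟨
      K * Zₚ * Pr pinnedVertices boundary     ≈⟨ *-congʳ Z-Zₚ ⟨
      Z pinnedVertices boundary * Pr pinnedVertices boundary  ≈⟨ *-/-cancel _ (Z-pos pinnedVertices boundary) ⟩
      N pinnedVertices boundary               ≈⟨ T-weight target (λ e → reflexive (≡.cong (λ y → 𝟙 (y Fin.≟ x)) (e v v∉Λ))) ⟩
      K * Nₚ                                  ∎)

  -- The contraction function bounds the one-step influence.

  module PottsContraction (q : ℕ) (1≤ιq : 1# ≤ ι q)
                          (β : ℝ) (0≤β : 0# ≤ β) (β<1 : β < 1#) where
    open Potts ℛ using (pottsδ)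

    private
      θ = 1# - β

      0<θ : 0# < θ
      0<θ = x<y⇒0<y-x β<1

      θ≤1 : θ ≤ 1#
      θ≤1 = ≤-by β 0≤β (solve 1 (λ β → (𝟏 :- β) :+ β := 𝟏) refl β)

      den : ℕ → ℝ
      den d = (ι q - 1#) - θ * ι d

      if-≤ : ∀ {A : Set} (A? : Dec A) {x y z} → (A → z ≤ x) → z ≤ y → z ≤ (if does A? then x else y)
      if-≤ (yes a) f _ = f a
      if-≤ (no _)  _ g = g

      0<ιq : 0# < ι q
      0<ιq = <-≤-trans 0<1 1≤ιq

      0<ι2 : 0# < ι 2
      0<ι2 = 0<ι-suc 1

      den-pos : ∀ d → ι d ≤ ((ι q - 1#) / θ - ι 2) → 0# < den d
      den-pos d h = <-≤-trans (*-pos 0<θ 0<ι2) (0≤y-x⇒x≤y (≤-respʳ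
        (trans (solve 4 (λ θ d r t → θ :* (r :- t :- d) := θ :* r :- θ :* d :- θ :* t) refl θ (ι d) ((ι q - 1#) / θ) (ι 2))
          (+-congʳ (+-congʳ (*-/-cancel _ 0<θ))))
        (*-nonneg (inj₁ 0<θ) (x≤y⇒0≤y-x h))))

    -- The one-step bound `θ / (q - θ d)` at `d = 0`, a positive lower bound for all values of
    -- `pottsδ q β`.
    δₘᵢₙ : ℝ
    δₘᵢₙ = θ / ι q

    δₘᵢₙ-pos : 0# < δₘᵢₙ
    δₘᵢₙ-pos = *-pos 0<θ (⁻¹-pos 0<ιq)

    -- Since `1 - β′ ≤ 1 - β`, the premise gives `κ (q - (1 - β) d) ≤ 1 - β`; `e` collects the slack
    -- up to `κ (q - 1 - (1 - β) d) ≤ 2 (1 - β)`. For large `d` the claim is `κ ≤ 1`.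
    pottsδ-bound : ∀ {β′} → β ≤ β′ → ∀ d κ → 0# ≤ κ → κ ≤ 1# →
                   κ * ι q ≤ (1# - β′) + κ * (ι d * (1# - β′)) → κ ≤ pottsδ q β d
    pottsδ-bound {β′} β≤β′ d κ 0≤κ κ≤1 h = if-≤ (ι d ≤? _)
      (λ low → ≤-/ (den-pos d low) (≤-by e (+-nonneg (+-nonneg (+-nonneg (+-nonneg
          (x≤y⇒0≤y-x h) 0≤κ) (*-nonneg 0≤κ (*-nonneg (0≤ι d) 0≤β′-β))) 0≤β′-β) (inj₁ 0<θ))
        (solve 5 (λ κ q b b′ d →
            κ :* ((q :- 𝟏) :- (𝟏 :- b) :* d) :+
            ((𝟏 :- b′) :+ κ :* (d :* (𝟏 :- b′)) :- κ :* q :+ κ :+ κ :* (d :* (b′ :- b)) :+ (b′ :- b) :+ (𝟏 :- b))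
            -- This spelling of 2 is what `ι 2` unfolds to.
            := (𝟏 :+ (𝟏 :+ 𝟎)) :* (𝟏 :- b)) refl κ (ι q) β β′ (ι d))))
      κ≤1
      where
      0≤β′-β = x≤y⇒0≤y-x β≤β′
      e = (1# - β′) + κ * (ι d * (1# - β′)) - κ * ι q + κ + κ * (ι d * (β′ - β)) + (β′ - β) + θ

    δₘᵢₙ≤pottsδ : ∀ d → δₘᵢₙ ≤ pottsδ q β d
    δₘᵢₙ≤pottsδ d = pottsδ-bound ≤-refl d δₘᵢₙ (inj₁ δₘᵢₙ-pos)
      (/-≤ 0<ιq (≤-trans θ≤1 (≤-respʳ (sym (*-identityˡ _)) 1≤ιq)))
      (≤-respˡ (sym (trans (*-comm _ _) (*-/-cancel _ 0<ιq)))
        (x≤x+y (*-nonneg (inj₁ δₘᵢₙ-pos) (*-nonneg (0≤ι d) (inj₁ 0<θ)))))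

  -- Real powers of the order.

  module Powers where
    open RealPower ℛ using (BelowPower; power; power-isSupremum)
    open SemiringExp semiring using (^-homo-*; ^-assocʳ)
    open CommutativeExp commutativeSemiring using (^-distrib-*)
    open SemiringMult semiring using (×-homo-+; ×1-homo-*)

    one-^ : ∀ k → 1# ^ k ≈ 1#
    one-^ zero    = refl
    one-^ (suc k) = trans (*-identityˡ _) (one-^ k)

    1≤power : ∀ n C C>0 → 1# ≤ power n C C>0
    1≤power n C C>0 = proj₁ (power-isSupremum n C C>0) 1#
      (0 , 0 , *-nonneg (inj₁ C>0) (0≤ι 1) , ≤-reflexive (one-^ 1))

    -- `n^(C + k) / n^k` bounds every element of the set whose supremum is `n^C`: the exponent
    -- `a / b` is shifted to `(a + k b) / b`.
    power-*-^ : ∀ n → 0# < ι n → ∀ C C>0 k C+k>0 → power n C C>0 * ι n ^ k ≤ power n (C + ι k) C+k>0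
    power-*-^ n 0<n C C>0 k C+k>0 = ≤-respˡ (*-comm _ _) (≤-respʳ (*-/-cancel _ 0<nᵏ)
      (*-monoˡ (inj₁ 0<nᵏ) (proj₂ (power-isSupremum n C C>0) (P / ι n ^ k) λ y y∈ →
        ≤-/ 0<nᵏ (proj₁ (power-isSupremum n (C + ι k) C+k>0) (y * ι n ^ k) (shift y y∈)))))
      where
      P = power n (C + ι k) C+k>0
      0<nᵏ = ^-pos 0<n k

      shift : ∀ y → BelowPower n C y → BelowPower n (C + ι k) (y * ι n ^ k)
      shift y (a , b′ , a≤Cb , yᵇ≤nᵃ) = a ℕ.+ k ℕ.* suc b′ , b′
        , ≤-resp (sym (trans (×-homo-+ 1# a (k ℕ.* suc b′)) (+-congˡ (×1-homo-* k (suc b′)))))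
            (sym (distribʳ _ _ _)) (+-mono-≤ a≤Cb ≤-refl)
        , ≤-resp
            (sym (trans (^-distrib-* y (ι n ^ k) (suc b′)) (*-congˡ (^-assocʳ (ι n) k (suc b′)))))
            (sym (^-homo-* (ι n) a (k ℕ.* suc b′)))
            (*-monoʳ (inj₁ (^-pos 0<n (k ℕ.* suc b′))) yᵇ≤nᵃ)

    -- Turns a constant into a power of `n` once `n ≥ 2`.
    1+ι≤^ : ∀ {y} → ι 2 ≤ y → ∀ k → 1# + ι k ≤ y ^ k
    1+ι≤^ {y} 2≤y zero    = ≤-reflexive (+-identityʳ 1#)
    1+ι≤^ {y} 2≤y (suc k) = ≤-trans (≤-trans
      (≤-by (ι k) (0≤ι k) (solve 1 (λ k → (𝟏 :+ (𝟏 :+ k)) :+ k := (𝟏 :+ (𝟏 :+ 𝟎)) :* (𝟏 :+ k)) refl (ι k)))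
      (*-monoˡ (0≤ι 2) (1+ι≤^ 2≤y k)))
      (*-monoʳ (≤-trans (+-nonneg 0≤1 (0≤ι k)) (1+ι≤^ 2≤y k)) 2≤y)

  -- Comparison of marginals at every activity, by a limit at zero.

  module FeasibleDecay {q : ℕ} (y₀ : Fin q) (G : Graph)
    (β : ℝ) (0≤β : 0# ≤ β) (β<1 : β < 1#)
    (δ : ℕ → ℝ) (0≤δ : ∀ d → 0# ≤ δ d)
    (δ-bound : ∀ {β′} → β ≤ β′ → ∀ d κ → 0# ≤ κ → κ ≤ 1# → κ * ι q ≤ (1# - β′) + κ * (ι d * (1# - β′)) → κ ≤ δ d)
    (v : Vertex G) (x : Fin q) (Λ : Subset (order G)) (v∉Λ : ¬ (v ∈ Λ)) where
    open WalkSums G δ 0≤δ v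
    open Potts ℛ using (Feasible; marginal; module Gibbs)

    difference? : ∀ (σ τ : PartialConfiguration q Λ) u → Dec (Difference σ τ u)
    difference? σ τ u with u ∈? Λ
    ... | no  u∉Λ = no λ d → u∉Λ (proj₁ d)
    ... | yes u∈Λ with σ u u∈Λ Fin.≟ τ u u∈Λ
    ...   | yes e = no λ d → proj₂ d e
    ...   | no ¬e = yes (u∈Λ , ¬e)

    total : (σ τ : PartialConfiguration q Λ) → ℝ
    total σ τ = sum λ u → 𝟙 (difference? σ τ u) * U (order G) (u ∷ Vector.[])

    total-nonneg : ∀ σ τ → 0# ≤ total σ τ
    total-nonneg σ τ = sum-nonneg {order G} λ u → *-nonneg (0≤𝟙 (difference? σ τ u)) (U-nonneg (order G) (u ∷ Vector.[]))

    module S (β′ : ℝ) (0≤β′ : 0# ≤ β′) (σ : PartialConfiguration q Λ) = PottsSums β′ 0≤β′ ⟨ G , Λ , σ ⟩ v x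

    -- Free of division, hence suited to the limit; `total σ τ` does not depend on `β′` because `δ`
    -- is that of the given `β`.
    soft : ∀ {β′} (0<β′ : 0# < β′) → β′ < 1# → β ≤ β′ → ∀ σ τ → let p = inj₁ 0<β′ in
           S.Nₚ β′ p σ * S.Zₚ β′ p τ ≤
           S.Nₚ β′ p τ * S.Zₚ β′ p σ + total σ τ * (S.Zₚ β′ p σ * S.Zₚ β′ p τ)
    soft {β′} 0<β′ β′<1 β≤β′ σ τ = ≤-resp
      (trans (solve 3 (λ a b c → a :* b :* c := a :* c :* b) refl _ _ _) (*-congʳ (Fσ.Zₚ*Pr v∉Λ)))
      (trans (solve 4 (λ a b c B → a :* b :* (c :+ B) := b :* c :* a :+ B :* (a :* b)) refl
          Zσ Zτ (Marginals.Pr q y₀ G β′ 0<β′ β′<1 v x Fτ.pinnedVertices Fτ.boundary) (total σ τ))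
        (+-congʳ (*-congʳ (Fτ.Zₚ*Pr v∉Λ))))
      (*-monoˡ (inj₁ (*-pos Fσ.Zₚ-positive Fτ.Zₚ-positive)) Pr≤)
      where
      module Fσ = FreeVertex y₀ β′ 0<β′ β′<1 ⟨ G , Λ , σ ⟩ v x
      module Fτ = FreeVertex y₀ β′ 0<β′ β′<1 ⟨ G , Λ , τ ⟩ v x
      open Decay q y₀ G β′ 0<β′ β′<1 δ 0≤δ (δ-bound β≤β′) v x using (boundary-influence)

      Zσ = S.Zₚ β′ (inj₁ 0<β′) σ
      Zτ = S.Zₚ β′ (inj₁ 0<β′) τ

      same : ∀ u → ¬ Difference σ τ u → Fσ.boundary u ≡ Fτ.boundary u
      same u ¬d with u ∈? Λ
      ... | no  _   = ≡.refl
      ... | yes u∈Λ with σ u u∈Λ Fin.≟ τ u u∈Λ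
      ...   | yes e = ≡.cong const e
      ...   | no ¬e = contradiction (u∈Λ , ¬e) ¬d

      Pr≤ = boundary-influence (difference? σ τ) {Fσ.pinnedVertices} {Fσ.boundary} {Fτ.boundary}
        (dec-false (v ∈? Λ) v∉Λ) (λ u d → dec-true (u ∈? Λ) (proj₁ d)) same

    -- This is `q^n`, the number of terms of a partition function, each of which moves by at most
    -- `ε`.
    configurations : ℝ
    configurations = ∑ᶠ {q} {order G} λ _ → 1#

    module _ (β≈0 : β ≈ 0#) {ε : ℝ} (0<ε : 0# < ε) (ε<1 : ε < 1#) (σ : PartialConfiguration q Λ) where
      private
        module S₀ = S β 0≤β σ
        module Sε = S ε (inj₁ 0<ε) σ
        open Instance ⟨ G , Λ , σ ⟩ using (agrees?)

        ^-lower : ∀ k → β ^ k ≤ ε ^ k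
        ^-lower zero    = ≤-refl
        ^-lower (suc k) = ≤-respˡ (sym (trans (*-congʳ β≈0) (zeroˡ _))) (Sε.^-nonneg (suc k))

        ^≤1 : ∀ k → ε ^ k ≤ 1#
        ^≤1 zero    = ≤-refl
        ^≤1 (suc k) = ≤-respʳ (*-identityˡ 1#) (*-mono-≤ (inj₁ 0<ε) (inj₁ ε<1) (Sε.^-nonneg k) (^≤1 k))

        -- Both powers are 1 at exponent 0; at any other exponent `ε ^ k ≤ ε`.
        ^-upper : ∀ k → ε ^ k ≤ β ^ k + ε
        ^-upper zero    = x≤x+y (inj₁ 0<ε)
        ^-upper (suc k) = ≤-trans (≤-respʳ (*-identityʳ ε) (*-monoˡ (inj₁ 0<ε) (^≤1 k)))
          (≤-respʳ (+-comm _ _) (x≤x+y (S₀.^-nonneg (suc k))))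

      weight-lower : ∀ π → Gibbs.weight β ⟨ G , Λ , σ ⟩ π ≤ Gibbs.weight ε ⟨ G , Λ , σ ⟩ π
      weight-lower π = ≤-resp (sym (S₀.weight-𝟙 π)) (sym (Sε.weight-𝟙 π))
        (*-monoˡ (0≤𝟙 (agrees? π)) (^-lower (Gibbs.monochromatic β ⟨ G , Λ , σ ⟩ π)))

      weight-upper : ∀ π → Gibbs.weight ε ⟨ G , Λ , σ ⟩ π ≤ Gibbs.weight β ⟨ G , Λ , σ ⟩ π + ε * 1#
      weight-upper π = ≤-resp (sym (Sε.weight-𝟙 π)) (+-congʳ (sym (S₀.weight-𝟙 π)))
        (≤-trans (*-monoˡ (0≤𝟙 (agrees? π)) (^-upper (Gibbs.monochromatic β ⟨ G , Λ , σ ⟩ π)))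
          (≤-respˡ (sym (distribˡ _ _ _)) (+-mono-≤ ≤-refl
            (≤-resp refl (*-comm _ _) (*-monoʳ (inj₁ 0<ε) (𝟙≤1 (agrees? π)))))))

      Z-lower : S₀.Zₚ ≤ Sε.Zₚ
      Z-lower = ∑ᶠ-mono weight-lower

      Z-upper : Sε.Zₚ ≤ S₀.Zₚ + ε * configurations
      Z-upper = ≤-respʳ (trans (∑ᶠ-distrib-+ _ _) (+-congˡ (sym (*-distribˡ-∑ᶠ ε _)))) (∑ᶠ-mono weight-upper)

      N-lower : S₀.Nₚ ≤ Sε.Nₚ
      N-lower = ∑ᶠ-mono λ π → *-monoˡ (0≤𝟙 (π v Fin.≟ x)) (weight-lower π)

      N-upper : Sε.Nₚ ≤ S₀.Nₚ + ε * configurations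
      N-upper = ≤-respʳ (trans (∑ᶠ-distrib-+ _ _) (+-congˡ (sym (*-distribˡ-∑ᶠ ε _)))) (∑ᶠ-mono λ π →
        ≤-trans (*-monoˡ (0≤𝟙 (π v Fin.≟ x)) (weight-upper π)) (≤-respˡ (sym (distribˡ _ _ _))
          (+-mono-≤ ≤-refl (≤-respʳ (*-identityˡ _)
            (*-monoʳ (*-nonneg (inj₁ 0<ε) 0≤1) (𝟙≤1 (π v Fin.≟ x)))))))

    cross : ∀ σ τ → S.Nₚ β 0≤β σ * S.Zₚ β 0≤β τ ≤
            S.Nₚ β 0≤β τ * S.Zₚ β 0≤β σ + total σ τ * (S.Zₚ β 0≤β σ * S.Zₚ β 0≤β τ)
    cross σ τ = [ (λ 0<β → soft 0<β β<1 ≤-refl σ τ) , atZero ]′ 0≤β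
      where
      Bound = S.Nₚ β 0≤β σ * S.Zₚ β 0≤β τ ≤
              S.Nₚ β 0≤β τ * S.Zₚ β 0≤β σ + total σ τ * (S.Zₚ β 0≤β σ * S.Zₚ β 0≤β τ)

      Nτ = S.Nₚ β 0≤β τ
      Zσ = S.Zₚ β 0≤β σ
      Zτ = S.Zₚ β 0≤β τ
      B  = total σ τ
      M′ = configurations
      -- The coefficient of `ε` after expanding the products of the upper bounds, with `ε²` bounded
      -- by `ε`.
      K  = M′ * (Nτ + Zσ + M′) + B * (M′ * (Zσ + Zτ + M′))

      0≤M : 0# ≤ M′
      0≤M = ∑ᶠ-nonneg λ _ → 0≤1

      Z-nonneg : ∀ σ → 0# ≤ S.Zₚ β 0≤β σ
      Z-nonneg σ = ≤-trans (S.Nₚ-nonneg β 0≤β σ) (S.Nₚ≤Zₚ β 0≤β σ)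

      0≤K : 0# ≤ K
      0≤K = +-nonneg (*-nonneg 0≤M (+-nonneg (+-nonneg (S.Nₚ-nonneg β 0≤β τ) (Z-nonneg σ)) 0≤M))
        (*-nonneg (total-nonneg σ τ) (*-nonneg 0≤M (+-nonneg (+-nonneg (Z-nonneg σ) (Z-nonneg τ)) 0≤M)))

      atZero : 0# ≈ β → Bound
      atZero 0≈β = limit-≤ 0≤K λ ε 0<ε ε<1 →
        let
          β≈0 = sym 0≈β
          0≤ε = inj₁ 0<ε
          0≤Z′τ = ≤-trans (Z-nonneg τ) (Z-lower β≈0 0<ε ε<1 τ)
          0≤Z′σ = ≤-trans (Z-nonneg σ) (Z-lower β≈0 0<ε ε<1 σ)
          0≤N′τ = ≤-trans (S.Nₚ-nonneg β 0≤β τ) (N-lower β≈0 0<ε ε<1 τ)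
          NτU = N-upper β≈0 0<ε ε<1 τ
          ZσU = Z-upper β≈0 0<ε ε<1 σ
          ZτU = Z-upper β≈0 0<ε ε<1 τ
        in ≤-trans (*-mono-≤ (S.Nₚ-nonneg β 0≤β σ) (N-lower β≈0 0<ε ε<1 σ) (Z-nonneg τ) (Z-lower β≈0 0<ε ε<1 τ))
          (≤-trans (soft 0<ε ε<1 (inj₁ (<.<-respˡ-≈ 0≈β 0<ε)) σ τ)
          (≤-trans (+-mono-≤ (*-mono-≤ 0≤N′τ NτU 0≤Z′σ ZσU)
              (*-monoˡ (total-nonneg σ τ) (*-mono-≤ 0≤Z′σ ZσU 0≤Z′τ ZτU)))
            (≤-by (ε * (M′ * M′ * (1# - ε) * (1# + B)))
              (*-nonneg 0≤ε (*-nonneg (*-nonneg (*-nonneg 0≤M 0≤M) (x≤y⇒0≤y-x (inj₁ ε<1))) (+-nonneg 0≤1 (total-nonneg σ τ))))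
              (solve 6 (λ n z t B m e →
                  ((n :+ e :* m) :* (z :+ e :* m) :+ B :* ((z :+ e :* m) :* (t :+ e :* m))) :+
                  e :* (m :* m :* (𝟏 :- e) :* (𝟏 :+ B))
                  := (n :* z :+ B :* (z :* t)) :+ e :* (m :* (n :+ z :+ m) :+ B :* (m :* (z :+ t :+ m))))
                refl Nτ Zσ Zτ B M′ ε))))

    marginal-≤ : ∀ σ τ → Feasible β ⟨ G , Λ , σ ⟩ → Feasible β ⟨ G , Λ , τ ⟩ →
                 marginal β ⟨ G , Λ , σ ⟩ v x ≤ marginal β ⟨ G , Λ , τ ⟩ v x + total σ τ
    marginal-≤ σ τ fσ fτ = *-cancelˡ-≤ (*-pos 0<Zσ 0<Zτ) (≤-resp
      (trans (*-congʳ (sym (S.Zₚ*marginal β 0≤β σ 0<Zσ))) (solve 3 (λ a b c → a :* b :* c := a :* c :* b) refl _ _ _))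
      (trans (+-congʳ (*-congʳ (sym (S.Zₚ*marginal β 0≤β τ 0<Zτ))))
        (solve 4 (λ a b c B → b :* c :* a :+ B :* (a :* b) := a :* b :* (c :+ B)) refl _ _ _ _))
      (cross σ τ))
      where
      0<Zσ = S.Zₚ-pos β 0≤β σ fσ
      0<Zτ = S.Zₚ-pos β 0≤β τ fτ

  -- Choice of constants and the final estimate.

  module StrongSpatialMixing
    (q : ℕ) (3≤q : 3 ℕ.≤ q) (β : ℝ) (0≤β : 0# ≤ β) (β<1 : β < 1#)
    (C : ℝ) (C>0 : 0# < C) (γ : ℝ) (0<γ : 0# < γ) (γ<1 : γ < 1#) where
    open Potts ℛ
    open Powers

    private
      1≤ι : ∀ {k} → 3 ℕ.≤ k → 1# ≤ ι k
      1≤ι {suc k} _ = 1≤ι-suc k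

      1≤ιq : 1# ≤ ι q
      1≤ιq = 1≤ι 3≤q

      δ : ℕ → ℝ
      δ = pottsδ q β

    open PottsContraction q 1≤ιq β 0≤β β<1

    0≤δ : ∀ d → 0# ≤ δ d
    0≤δ d = ≤-trans (inj₁ δₘᵢₙ-pos) (δₘᵢₙ≤pottsδ d)

    m : ℕ
    m = proj₁ (archimedean (1# / δₘᵢₙ))

    -- The summand `m` pays for the missing factor of the starting vertex, through
    -- `1 / δₘᵢₙ ≤ m ≤ n^m`, and 1 pays for the number of walk lengths.
    C′ : ℝ
    C′ = C + ι (suc m)

    C′>0 : 0# < C′
    C′>0 = <-≤-trans C>0 (x≤x+y (0≤ι (suc m)))

    1≤δₘᵢₙ*ιm : 1# ≤ δₘᵢₙ * ι m
    1≤δₘᵢₙ*ιm = ≤-respˡ (*-/-cancel 1# δₘᵢₙ-pos)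
      (*-monoˡ (inj₁ δₘᵢₙ-pos) (inj₁ (proj₂ (archimedean (1# / δₘᵢₙ)))))

    absorb : ∀ n → 2 ℕ.≤ n → ∀ {S g} → 0# ≤ S → 0# ≤ g → δₘᵢₙ * S ≤ ι n * (power n C C>0 * g) →
             S ≤ power n C′ C′>0 * g
    absorb n 2≤n {S} {g} 0≤S 0≤g h = ≤-trans
      (≤-resp (*-identityˡ S) (solve 3 (λ f m s → f :* m :* s := m :* (f :* s)) refl δₘᵢₙ (ι m) S) (*-monoʳ 0≤S 1≤δₘᵢₙ*ιm))
      (≤-trans (*-mono-≤ (0≤ι m) ιm≤ (*-nonneg (inj₁ δₘᵢₙ-pos) 0≤S) h)
        (≤-respˡ (solve 4 (λ p x y g → p :* (x :* y) :* g := y :* (x :* (p :* g))) refl (power n C C>0) (ι n) (ι n ^ m) g)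
          (*-monoʳ 0≤g (power-*-^ n 0<ιn C C>0 (suc m) C′>0))))
      where
      2≤ιn : ι 2 ≤ ι n
      2≤ιn = ≮⇒≥ λ ιn<2 → ℕ.<⇒≱ (ι-cancel-< ιn<2) 2≤n
        where
        ι-cancel-< : ι n < ι 2 → n ℕ.< 2
        ι-cancel-< p with n ℕ.<? 2
        ... | yes n<2 = n<2
        ... | no  n≮2 with ℕ.m≤n⇒m<n∨m≡n (ℕ.≮⇒≥ n≮2)
        ...   | inj₁ 2<n    = contradiction p (<.asym (RealPower.ι-mono-< ℛ 2<n))
        ...   | inj₂ ≡.refl = contradiction p (<.irrefl refl)

      0<ιn : 0# < ι n
      0<ιn = <-≤-trans (0<ι-suc 1) 2≤ιn

      ιm≤ : ι m ≤ ι n ^ m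
      ιm≤ = ≤-trans (≤-respʳ (+-comm _ _) (x≤x+y 0≤1)) (1+ι≤^ 2≤ιn m)

    module _ (G : Graph) (v : Vertex G) (x : Fin q) (Λ : Subset (order G))
             (h : ∀ ℓ → 1 ℕ.≤ ℓ → ℰ G δ v ℓ < power (order G) C C>0 * γ ^ ℓ) where

      private
        n  = order G
        P  = power n C C>0
        P′ = power n C′ C′>0

      0≤P : 0# ≤ P
      0≤P = ≤-trans 0≤1 (1≤power n C C>0)

      0≤P′ : 0# ≤ P′
      0≤P′ = ≤-trans 0≤1 (1≤power n C′ C′>0)

      -- Excludes `n = 1`, where no power of `n` could absorb a constant.
      2≤order : ∀ {n} (G : Graph) → order G ≡ n → ∀ {u w} → Graph.Adj G u w → 2 ℕ.≤ n
      2≤order {suc (suc n)} G _ _ = ℕ.s≤s (ℕ.s≤s ℕ.z≤n)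
      2≤order {zero} G ≡.refl {u} e with () ← Fin.¬Fin0 u
      2≤order {suc zero} G eq e = contradiction e (Graph.Adj-irrefl G (unique eq _ _))
        where
        unique : ∀ {k} → k ≡ 1 → (u w : Fin k) → u ≡ w
        unique ≡.refl zero zero = ≡.refl

      module _ (σ τ : PartialConfiguration q Λ)
               (fσ : Feasible β ⟨ G , Λ , σ ⟩) (fτ : Feasible β ⟨ G , Λ , τ ⟩) where
        private
          module Pσ = PottsSums β 0≤β ⟨ G , Λ , σ ⟩ v x
          module Pτ = PottsSums β 0≤β ⟨ G , Λ , τ ⟩ v x
          0<Zσ = Pσ.Zₚ-pos fσ
          0<Zτ = Pτ.Zₚ-pos fτ
          Mσ = marginal β ⟨ G , Λ , σ ⟩ v x
          Mτ = marginal β ⟨ G , Λ , τ ⟩ v x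

        agreeing : ∀ {b} → 0# ≤ b → (v∈Λ : v ∈ Λ) → ¬ Difference σ τ v → Mσ ≤ Mτ + b
        agreeing 0≤b v∈Λ v∉D with σ v v∈Λ Fin.≟ τ v v∈Λ
        ... | no  σ≢τ = contradiction (v∈Λ , σ≢τ) v∉D
        ... | yes σ≡τ = ≤-respˡ (trans (Pτ.marginal-pinned 0<Zτ v∈Λ) (trans
          (reflexive (≡.cong (λ y → 𝟙 (y Fin.≟ x)) (≡.sym σ≡τ))) (sym (Pσ.marginal-pinned 0<Zσ v∈Λ))))
          (x≤x+y 0≤b)

        module Free (v∉Λ : ¬ (v ∈ Λ)) where
          -- The witness of feasibility supplies the default colour.
          open FeasibleDecay (proj₁ fσ v) G β 0≤β β<1 δ 0≤δ pottsδ-bound v x Λ v∉Λ public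
          open WalkSums G δ 0≤δ v using (∑-U-≤)

          δₘᵢₙ*total : ∀ d → IsDistance G v (Difference σ τ) d → δₘᵢₙ * total σ τ ≤ ι n * (P * γ ^⁺ d)
          δₘᵢₙ*total d dist = ∑-U-≤ (difference? σ τ) 0<γ γ<1 0≤P h δₘᵢₙ≤pottsδ d dist n

          far : ∀ d → IsDistance G v (Difference σ τ) d → total σ τ ≤ P′ * γ ^⁺ d → Mσ ≤ Mτ + P′ * γ ^⁺ d
          far d dist p = ≤-trans (marginal-≤ σ τ fσ fτ) (+-mono-≤ ≤-refl p)

        marginal-decay : ∀ d → IsDistance G v (Difference σ τ) d → Mσ ≤ Mτ + P′ * γ ^⁺ d
        -- At distance zero the right-hand side is at least 1.
        marginal-decay [ zero ] _ = ≤-trans (Pσ.marginal≤1 0<Zσ) (≤-trans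
          (≤-respʳ (sym (*-identityʳ P′)) (1≤power n C′ C′>0))
          (≤-respʳ (+-comm _ _) (x≤x+y (Pτ.marginal-nonneg 0<Zτ))))
        marginal-decay [ suc k ] dist@((u , d , (e Graph.∷ _)) , least) with v ∈? Λ
        ... | yes v∈Λ = agreeing (*-nonneg 0≤P′ (inj₁ (^-pos 0<γ (suc k)))) v∈Λ
          λ v∈D → contradiction (least v 0 v∈D Graph.[]) λ ()
        ... | no v∉Λ = far [ suc k ] dist
          (absorb n (2≤order G ≡.refl e) (total-nonneg σ τ) (inj₁ (^-pos 0<γ (suc k))) (δₘᵢₙ*total [ suc k ] dist))
          where
          open Free v∉Λ
        -- With `D` out of reach the walk sum is at most 0, so no constant has to be absorbed and
        -- the order may be 1.
        marginal-decay ⊤⁺ dist with v ∈? Λ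
        ... | yes v∈Λ = agreeing (≤-reflexive (sym (zeroʳ P′))) v∈Λ λ v∈D → dist v 0 v∈D Graph.[]
        ... | no v∉Λ = far ⊤⁺ dist (≤-respʳ (sym (zeroʳ P′)) (*-cancelˡ-≤ δₘᵢₙ-pos
          (≤-respʳ (trans (trans (*-congˡ (zeroʳ P)) (zeroʳ _)) (sym (zeroʳ δₘᵢₙ))) (δₘᵢₙ*total ⊤⁺ dist))))
          where
          open Free v∉Λ

    IsDistance-sym : ∀ {G : Graph} {v : Vertex G} {Λ : Subset (order G)} (σ τ : PartialConfiguration q Λ) d →
      IsDistance G v (Difference σ τ) d → IsDistance G v (Difference τ σ) d
    IsDistance-sym σ τ [ k ] ((u , (u∈Λ , σ≢τ) , w) , least) =
      (u , (u∈Λ , σ≢τ ∘ ≡.sym) , w) , λ { t j (t∈Λ , τ≢σ) → least t j (t∈Λ , τ≢σ ∘ ≡.sym) }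
    IsDistance-sym σ τ ⊤⁺ far = λ { t j (t∈Λ , τ≢σ) → far t j (t∈Λ , τ≢σ ∘ ≡.sym) }

mainTheorem2 : ∀ {a} (ℛ : RealNumbers) → let open RealNumbers ℛ in let open Potts ℛ in
    (q : ℕ) → 3 ℕ.≤ q →
    (β : ℝ) → 0# ≤ β → β < 1# →
    (𝒢 : Graph → Set a) →
    IsContractionFunction 𝒢 (pottsδ q β) →
    (β ≈ 0# → ∀ G → 𝒢 G → ProperlyColorable G q) →
    ∃[ C ] Σ[ C>0 ∈ 0# < C ] ∃[ γ ] 0# < γ × γ < 1# ×
    (∀ G → 𝒢 G →
    ∀ (v : Vertex G) (Λ : Subset (order G)) (x : Fin q)
    (σ τ : PartialConfiguration q Λ) →
    Feasible β ⟨ G , Λ , σ ⟩ → Feasible β ⟨ G , Λ , τ ⟩ →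
    ∀ d → IsDistance G v (Difference σ τ) d →
    ∣ marginal β ⟨ G , Λ , σ ⟩ v x - marginal β ⟨ G , Λ , τ ⟩ v x ∣
    ≤ power (order G) C C>0 * γ ^⁺ d)
mainTheorem2 ℛ q 3≤q β 0≤β β<1 𝒢 (_ , C , C>0 , γ , 0<γ , γ<1 , h) _ =
  C′ , C′>0 , γ , 0<γ , γ<1 , λ G G∈𝒢 v Λ x σ τ fσ fτ d dist →
    OrderedField.∣x-y∣≤b ℛ
      (marginal-decay G v x Λ (h G G∈𝒢 v) σ τ fσ fτ d dist)
      (marginal-decay G v x Λ (h G G∈𝒢 v) τ σ fτ fσ d (IsDistance-sym σ τ d dist))
  where
  open SpinSystem.StrongSpatialMixing ℛ q 3≤q β 0≤β β<1 C C>0 γ 0<γ γ<1
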